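{- Let $G=(V,E)$ be a $3$-connected graph and $C\subseteq G$ a non-interleaved cycle. Then $\sum_{e\in E(C)}x_e\le 2$ defines a facet of $\textsc{Bond}(G)$.
   Context: For a connected graph $G=(V,E)$ and $S\subseteq V$, the cut $\delta(S)=\{e\in E:|e\cap S|=1\}$ is a bond if $G[S]$ and $G[V\setminus S]$ are both connected. The incidence vector $x^\delta\in\mathbb{R}^E$ has $x^\delta_e=1$ iff $e\in\delta$. $\textsc{Bond}(G)=\mathrm{conv}\{x^\delta:\delta\text{ a bond}\}$. A cycle $C\subseteq G$ is interleaved if there are vertices $v_1,v_2,v_3,v_4\in V(C)$ occurring along $C$ in this order and vertex-disjoint paths in $G-E(C)$ connecting $v_1$ with $v_3$ and $v_2$ with $v_4$, respectively; otherwise it is non-interleaved. Graphs are simple.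
   Formalization: The bond polytope is taken in ℚ^E with rational convex coefficients (and affine independence over ℚ) instead of ℝ^E; since its vertices are 0/1 vectors, validity and dimensions agree with the real ones. -}

module Defs where

open import Data.Nat as ℕ using (ℕ; zero; suc; _≤_)
open import Data.Nat.DivMod using (_mod_)
open import Data.Fin as Fin using (Fin; zero; suc; toℕ; fromℕ; inject₁)
open import Data.Fin.Subset using (Subset; _∈_; _∉_; ∁; ∣_∣)
open import Data.Bool using (Bool; true; false; _xor_)
open import Data.Vec using (lookup)
open import Data.Product using (Σ; ∃; _×_; _,_; proj₁; proj₂)
open import Data.Sum using (_⊎_)
open import Relation.Binary.PropositionalEquality using (_≡_; _≢_)
open import Relation.Nullary using (¬_)
open import Data.Rational as ℚ using (ℚ; 0ℚ; 1ℚ; _+_; _*_)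

-- Finite simple graphs: vertices Fin n, edges Fin m; edge e has ends
-- (a , b) with a < b (no loops), and distinct edges have distinct end
-- pairs (no parallel edges).  ℝ^E is modelled as ℚ^E = Fin m → ℚ.

record Graph : Set where
  field
    n m    : ℕ
    ends   : Fin m → Fin n × Fin n
    noLoop : ∀ e → proj₁ (ends e) Fin.< proj₂ (ends e)
    simple : ∀ e f → ends e ≡ ends f → e ≡ f

module _ (G : Graph) where
  open Graph G

  Joins : Fin m → Fin n → Fin n → Set
  Joins e u v = (ends e ≡ (u , v)) ⊎ (ends e ≡ (v , u))

  record Walk (okV : Fin n → Set) (okE : Fin m → Set) (u v : Fin n) : Set where
    field
      len  : ℕ
      vert : Fin (suc len) → Fin n
      start : vert zero ≡ u
      stop  : vert (fromℕ len) ≡ v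
      vOk   : ∀ i → okV (vert i)
      step  : ∀ (i : Fin len) → ∃ λ e → Joins e (vert (inject₁ i)) (vert (suc i)) × okE e

  anyEdge : Fin m → Set
  anyEdge _ = Fin 1

  ConnectedOn : Subset n → Set
  ConnectedOn S = (∃ λ u → u ∈ S) × (∀ u v → u ∈ S → v ∈ S → Walk (_∈ S) anyEdge u v)

  ThreeConnected : Set
  ThreeConnected = 4 ≤ n × (∀ (X : Subset n) → ∣ X ∣ ≤ 2 → ConnectedOn (∁ X))

  IsBond : Subset n → Set
  IsBond S = ConnectedOn S × ConnectedOn (∁ S)

  cutVec : Subset n → Fin m → ℚ
  cutVec S e with lookup S (proj₁ (ends e)) xor lookup S (proj₂ (ends e))
  ... | true  = 1ℚ
  ... | false = 0ℚ

Σℚ : ∀ {k} → (Fin k → ℚ) → ℚ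
Σℚ {zero}  f = 0ℚ
Σℚ {suc k} f = f zero + Σℚ (λ i → f (suc i))

module _ (G : Graph) where
  open Graph G

  InBondPolytope : (Fin m → ℚ) → Set
  InBondPolytope x =
    ∃ λ k → Σ (Fin k → Subset n) λ S → Σ (Fin k → ℚ) λ λs →
      (∀ i → IsBond G (S i)) × (∀ i → 0ℚ ℚ.≤ λs i) × Σℚ λs ≡ 1ℚ ×
      (∀ e → x e ≡ Σℚ (λ i → λs i * cutVec G (S i) e))

AffinelyIndependent : ∀ {m k} → (Fin k → Fin m → ℚ) → Set
AffinelyIndependent {m} {k} p =
  ∀ (μ : Fin k → ℚ) → Σℚ μ ≡ 0ℚ → (∀ e → Σℚ (λ i → μ i * p i e) ≡ 0ℚ) → ∀ i → μ i ≡ 0ℚ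

HasAffIndep : ∀ {m} → ((Fin m → ℚ) → Set) → ℕ → Set
HasAffIndep {m} P k = Σ (Fin k → Fin m → ℚ) λ p → (∀ i → P (p i)) × AffinelyIndependent p

HasDim : ∀ {m} → ((Fin m → ℚ) → Set) → ℕ → Set
HasDim P d = HasAffIndep P (suc d) × ¬ HasAffIndep P (suc (suc d))

DefinesFacet : ∀ {m} → ((Fin m → ℚ) → Set) → (Fin m → ℚ) → ℚ → Set
DefinesFacet {m} P a β =
  (∀ x → P x → Σℚ (λ e → a e * x e) ℚ.≤ β) ×
  ∃ λ d → HasDim (λ x → P x × Σℚ (λ e → a e * x e) ≡ β) d × HasDim P (suc d)

-- Cycles: a cycle of length k = suc k' ≥ 3 is given by distinct vertices
-- c 0, …, c k' and edges ce i joining c i and c (i+1 mod k).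

module _ (G : Graph) where
  open Graph G

  nextF : ∀ {k'} → Fin (suc k') → Fin (suc k')
  nextF {k'} i = suc (toℕ i) mod (suc k')

  record Cycle : Set where
    field
      k'     : ℕ
      long   : 2 ≤ k'
      vtx    : Fin (suc k') → Fin n
      vInj   : ∀ i j → vtx i ≡ vtx j → i ≡ j
      edg    : Fin (suc k') → Fin m
      edgOk  : ∀ i → Joins G (edg i) (vtx i) (vtx (nextF i))

  InCycle : Cycle → Fin m → Set
  InCycle C e = ∃ λ i → Cycle.edg C i ≡ e

  cycleVec : Cycle → Fin m → ℚ
  cycleVec C e = Σℚ (λ i → indic (Cycle.edg C i))
    where
      indic : Fin m → ℚ
      indic f with f Fin.≟ e
      ... | Relation.Nullary.yes _ = 1ℚ
      ... | Relation.Nullary.no _  = 0ℚ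

  Interleaved : Cycle → Set
  Interleaved C =
    ∃ λ i₁ → ∃ λ i₂ → ∃ λ i₃ → ∃ λ i₄ →
      i₁ Fin.< i₂ × i₂ Fin.< i₃ × i₃ Fin.< i₄ ×
      Σ (Walk G (λ _ → Fin 1) (λ e → ¬ InCycle C e) (v i₁) (v i₃)) λ P →
      Σ (Walk G (λ _ → Fin 1) (λ e → ¬ InCycle C e) (v i₂) (v i₄)) λ Q →
        ∀ a b → Walk.vert P a ≢ Walk.vert Q b
    where v = Cycle.vtx C

twoℚ : ℚ
twoℚ = 1ℚ + 1ℚ

{-# OPTIONS --safe #-}
module Submission where

-- Call a bond splitting if it separates two vertices of C.  If a bond met C in four edges, the
-- connectivity of its two sides would yield two disjoint paths interleaving C; so every splitting
-- bond meets C in exactly two edges, and the others miss C.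
--
-- The splitting bonds span ℚ^E.  For an edge uv, 2·1_{uv} = x^{δ(u)} + x^{δ(v)} − x^{δ({u,v})}, so
-- it suffices to treat x^{δ(U)} for U = {u}, {v}, {u,v}.  If U meets C, then δ(U) is itself a
-- splitting bond.  Otherwise Menger's theorem gives three disjoint paths from the neighbourhood of U
-- to C, and these extend to a partition of V ∖ U into connected sets Z₁, Z₂, Z₃.  The Zᵢ are pairwise
-- adjacent along C, all δ(Zᵢ) and δ(Zᵢ ∪ U) are splitting bonds, and
-- x^{δ(U)} = Σᵢ (x^{δ(Zᵢ ∪ U)} − x^{δ(Zᵢ)}).
--
-- Hence the face has dimension |E| − 1.  It is proper: 3-connectivity forces a vertex off C (else
-- some chord would be a bond crossing C four times), and the star of that vertex misses C.

open import Defs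
open import Data.Bool using (Bool; true; false; not; _xor_; _∨_)
import Data.Bool.Properties as Boolₚ
open import Data.Empty using (⊥; ⊥-elim)
open import Data.Fin as Fin using (Fin; zero; suc; toℕ; fromℕ; fromℕ<; inject₁; inject≤; punchIn; punchOut)
open import Data.Fin.Patterns using (0F; 1F; 2F)
import Data.Fin.Properties as Finₚ
open import Data.Fin.Subset as Subset using (Subset; ∁)
import Data.Fin.Subset.Properties as Subsetₚ
open import Data.List as List using (List; []; _∷_; length; filter; allFin)
import Data.List.Properties as Listₚ
open import Data.List.Membership.Propositional using (_∈_; _∉_; find)
open import Data.List.Membership.Propositional.Properties using (∈-filter⁺; ∈-filter⁻; ∈-allFin; ∈-lookup; ∈-map⁺; ∈-map⁻)
open import Data.List.Relation.Unary.All as All using ()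
open import Data.List.Relation.Unary.AllPairs using (_∷_)
open import Data.List.Relation.Unary.Any as Any using (Any; here; there; index)
open import Data.List.Relation.Unary.Any.Properties using (lookup-index)
open import Data.List.Relation.Unary.Unique.Propositional using (Unique)
open import Data.List.Relation.Unary.Unique.Propositional.Properties using (filter⁺; allFin⁺)
open import Data.Maybe using (Maybe; just; nothing)
open import Data.Nat as ℕ using (ℕ; zero; suc; z≤n; s≤s)
import Data.Nat.Properties as ℕₚ
open import Data.Nat.DivMod using (_%_; m<n⇒m%n≡m; n%n≡0; m%n<n)
open import Data.Product using (Σ; ∃; _×_; _,_; proj₁; proj₂)
open import Data.Product.Properties using (≡-dec)
open import Data.Rational as ℚ using (ℚ; 0ℚ; 1ℚ; _+_; _*_; _-_; -_; 1/_)
open import Data.Rational.Properties as ℚₚ using (+-identityˡ; +-identityʳ; +-inverseʳ; *-identityˡ; *-identityʳ; *-zeroˡ; *-zeroʳ; *-distribˡ-+; *-assoc; *-comm; *-inverseʳ)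
open import Data.Rational.Solver using (module +-*-Solver)
open import Data.Sum using (_⊎_; inj₁; inj₂)
open import Data.Vec as Vec using (_∷_; lookup; _[_]≔_)
import Data.Vec.Properties as Vecₚ
open import Function using (_∘_; id)
open import Relation.Binary.Definitions using (tri<; tri≈; tri>)
open import Relation.Binary.PropositionalEquality
open import Relation.Nullary using (¬_; Dec; yes; no; does; ¬?; _×-dec_; _⊎-dec_; _→-dec_)
open import Relation.Nullary.Decidable using (decidable-stable; from-yes; dec-true; dec-false; map′)
open import Relation.Unary using (Decidable)

open +-*-Solver using (solve; _:=_; _:+_; _:*_; :-_)

-- Linear algebra

-- Why three classes: with r of them, the sum of all x^{δ(Zᵢ ∪ U)} - x^{δ(Zᵢ)} counts an edge
-- leaving U exactly r - 2 times and cancels on every other edge, so r = 3 yields x^{δ(U)}. The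
-- complement of Zᵢ is connected through U, but that of Zᵢ ∪ U consists of the two other classes and
-- needs an edge between them. This is where non-interleaving enters a second time: δ(Zᵢ) is a
-- splitting bond, so it meets C twice and Zᵢ meets C in a single arc; of three arcs that exhaust a
-- cycle, any two are consecutive. Spanning is used in dual form: for every nonzero b some splitting
-- bond has b · x ≠ 0. This allows independent points to be chosen one at a time, and they are
-- affinely independent because the face lies in a hyperplane missing the origin. The obstacle in
-- the two-edge claim is that a path inside one side of a bond may run along C, whereas interleaving
-- asks for paths in G - E(C). From each path an excursion between two arcs of C is extracted; the
-- ends of the first excursion then bound the arcs for the second.

Σ-cong : ∀ {k} {f g : Fin k → ℚ} → (∀ i → f i ≡ g i) → Σℚ f ≡ Σℚ g
Σ-cong {zero}  h = refl
Σ-cong {suc k} h = cong₂ _+_ (h zero) (Σ-cong (λ i → h (suc i)))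

Σ-zero : ∀ {k} {f : Fin k → ℚ} → (∀ i → f i ≡ 0ℚ) → Σℚ f ≡ 0ℚ
Σ-zero {zero}  h = refl
Σ-zero {suc k} h = cong₂ _+_ (h zero) (Σ-zero (λ i → h (suc i)))

+-interchange : ∀ a b c d → (a + b) + (c + d) ≡ (a + c) + (b + d)
+-interchange = solve 4 (λ a b c d → (a :+ b) :+ (c :+ d) := (a :+ c) :+ (b :+ d)) refl

Σ-+ : ∀ {k} (f g : Fin k → ℚ) → Σℚ (λ i → f i + g i) ≡ Σℚ f + Σℚ g
Σ-+ {zero}  f g = refl
Σ-+ {suc k} f g = trans (cong (f zero + g zero +_) (Σ-+ (λ i → f (suc i)) (λ i → g (suc i))))
                        (+-interchange (f zero) (g zero) _ _)

Σ-*ˡ : ∀ {k} (c : ℚ) (f : Fin k → ℚ) → Σℚ (λ i → c * f i) ≡ c * Σℚ f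
Σ-*ˡ {zero}  c f = sym (*-zeroʳ c)
Σ-*ˡ {suc k} c f = trans (cong (c * f zero +_) (Σ-*ˡ c (λ i → f (suc i))))
                         (sym (*-distribˡ-+ c (f zero) _))

Σ-swap : ∀ {k l} (f : Fin k → Fin l → ℚ) →
         Σℚ (λ i → Σℚ (λ j → f i j)) ≡ Σℚ (λ j → Σℚ (λ i → f i j))
Σ-swap {zero} {l} f = sym (Σ-zero {l} (λ _ → refl))
Σ-swap {suc k} f = trans (cong (Σℚ (f zero) +_) (Σ-swap (λ i → f (suc i))))
                         (sym (Σ-+ (f zero) (λ j → Σℚ (λ i → f (suc i) j))))

Σ-last : ∀ {k} (f : Fin (suc k) → ℚ) → Σℚ f ≡ Σℚ (λ i → f (inject₁ i)) + f (fromℕ k)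
Σ-last {zero}  f = trans (+-identityʳ (f zero)) (sym (+-identityˡ (f zero)))
Σ-last {suc k} f = trans (cong (f zero +_) (Σ-last (λ i → f (suc i)))) (sym (ℚₚ.+-assoc (f zero) _ _))

Σ-mono : ∀ {k} {f g : Fin k → ℚ} → (∀ i → f i ℚ.≤ g i) → Σℚ f ℚ.≤ Σℚ g
Σ-mono {zero}  h = ℚₚ.≤-refl
Σ-mono {suc k} h = ℚₚ.+-mono-≤ (h zero) (Σ-mono (λ i → h (suc i)))

infixl 7 _·_
_·_ : ∀ {k} → (Fin k → ℚ) → (Fin k → ℚ) → ℚ
x · y = Σℚ (λ i → x i * y i)

·-comm : ∀ {k} (x y : Fin k → ℚ) → x · y ≡ y · x
·-comm x y = Σ-cong (λ i → *-comm (x i) (y i))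

·-+ : ∀ {k} (b x y : Fin k → ℚ) → b · (λ e → x e + y e) ≡ b · x + b · y
·-+ b x y = trans (Σ-cong (λ e → *-distribˡ-+ (b e) (x e) (y e))) (Σ-+ (λ e → b e * x e) (λ e → b e * y e))

·-combination : ∀ {k l} (a : Fin l → ℚ) (c : Fin k → ℚ) (p : Fin k → Fin l → ℚ) →
                a · (λ e → c · (λ i → p i e)) ≡ c · (λ i → a · p i)
·-combination a c p = begin
  Σℚ (λ e → a e * Σℚ (λ i → c i * p i e))   ≡⟨ Σ-cong (λ e → sym (Σ-*ˡ (a e) (λ i → c i * p i e))) ⟩
  Σℚ (λ e → Σℚ (λ i → a e * (c i * p i e))) ≡⟨ Σ-swap (λ e i → a e * (c i * p i e)) ⟩
  Σℚ (λ i → Σℚ (λ e → a e * (c i * p i e))) ≡⟨ Σ-cong (λ i → Σ-cong (λ e → rearrange (a e) (c i) (p i e))) ⟩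
  Σℚ (λ i → Σℚ (λ e → c i * (a e * p i e))) ≡⟨ Σ-cong (λ i → Σ-*ˡ (c i) (λ e → a e * p i e)) ⟩
  Σℚ (λ i → c i * Σℚ (λ e → a e * p i e))   ∎
  where
  open ≡-Reasoning
  rearrange : ∀ x y z → x * (y * z) ≡ y * (x * z)
  rearrange = solve 3 (λ x y z → x :* (y :* z) := y :* (x :* z)) refl

δ : ∀ {k} → Fin k → Fin k → ℚ
δ i j with i Fin.≟ j
... | yes _ = 1ℚ
... | no _  = 0ℚ

Σ-δ : ∀ {k} (i : Fin k) (f : Fin k → ℚ) → Σℚ (λ j → δ i j * f j) ≡ f i
Σ-δ {suc k} zero f = trans (cong₂ _+_ (*-identityˡ (f zero)) (Σ-zero (λ j → *-zeroˡ (f (suc j)))))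
                           (+-identityʳ (f zero))
Σ-δ {suc k} (suc i) f = trans (cong₂ _+_ (*-zeroˡ (f zero))
                                (trans (Σ-cong (λ j → cong (_* f (suc j)) (δ-suc j))) (Σ-δ i (λ j → f (suc j)))))
                              (+-identityˡ _)
  where
  δ-suc : ∀ j → δ (suc i) (suc j) ≡ δ i j
  δ-suc j with i Fin.≟ j
  ... | yes _ = refl
  ... | no _  = refl

δ-same : ∀ {k} {i j : Fin k} → i ≡ j → δ i j ≡ 1ℚ
δ-same {i = i} {j} eq with i Fin.≟ j
... | yes _ = refl
... | no ne = ⊥-elim (ne eq)

δ-different : ∀ {k} {i j : Fin k} → i ≢ j → δ i j ≡ 0ℚ
δ-different {i = i} {j} ne with i Fin.≟ j
... | yes eq = ⊥-elim (ne eq)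
... | no _   = refl

*-cancel-0 : ∀ {p q} → q ≢ 0ℚ → p * q ≡ 0ℚ → p ≡ 0ℚ
*-cancel-0 {p} {q} q≢0 pq≡0 = begin
  p                ≡⟨ sym (*-identityʳ p) ⟩
  p * 1ℚ           ≡⟨ cong (p *_) (sym (*-inverseʳ q)) ⟩
  p * (q * 1/ q)   ≡⟨ sym (*-assoc p q _) ⟩
  (p * q) * 1/ q   ≡⟨ cong (_* 1/ q) pq≡0 ⟩
  0ℚ * 1/ q        ≡⟨ *-zeroˡ (1/ q) ⟩
  0ℚ               ∎
  where
  open ≡-Reasoning
  instance _ = ℚ.≢-nonZero q≢0

NonZeroVector : ∀ {k} → (Fin k → ℚ) → Set
NonZeroVector x = ∃ λ i → x i ≢ 0ℚ

-- Gaussian elimination on the first column: without a pivot there, the first unit vector is a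
-- solution; otherwise the pivot row removes the first variable from all other rows, which leaves
-- one row and one column fewer.
underdetermined : ∀ {k l} → k ℕ.< l → (A : Fin k → Fin l → ℚ) →
                  ∃ λ x → NonZeroVector x × ∀ i → A i · x ≡ 0ℚ
underdetermined {k} {suc l} (s≤s k≤l) A with Finₚ.any? (λ i → ¬? (A i zero ℚₚ.≟ 0ℚ))
... | no column₀≡0 = δ zero , (zero , λ ()) , λ i → begin
  A i · δ zero   ≡⟨ ·-comm (A i) (δ zero) ⟩
  δ zero · A i   ≡⟨ Σ-δ zero (A i) ⟩
  A i zero       ≡⟨ decidable-stable (A i zero ℚₚ.≟ 0ℚ) (λ ≢0 → column₀≡0 (i , ≢0)) ⟩
  0ℚ             ∎
  where open ≡-Reasoning
underdetermined {suc k} {suc l} (s≤s k<l) A | yes (r , pivot≢0) = x , (suc (proj₁ y≢0) , proj₂ y≢0) , x-solves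
  where
  open ≡-Reasoning
  instance _ = ℚ.≢-nonZero pivot≢0
  π = A r zero
  row : Fin (suc k) → Fin l → ℚ
  row i j = A i (suc j)
  A′ : Fin k → Fin l → ℚ
  A′ i j = row (punchIn r i) j + - (A (punchIn r i) zero * 1/ π) * row r j
  solution = underdetermined k<l A′
  y = proj₁ solution
  y≢0 = proj₁ (proj₂ solution)
  -- Back-substitution: the value of the first variable forced by the pivot row.
  x₀ = - (1/ π * (row r · y))
  x : Fin (suc l) → ℚ
  x zero    = x₀
  x (suc j) = y j
  reduced : ∀ i → A′ i · y ≡ row (punchIn r i) · y + - (A (punchIn r i) zero * 1/ π) * (row r · y)
  reduced i = begin
    A′ i · y
      ≡⟨ Σ-cong (λ j → distr (row (punchIn r i) j) c (row r j) (y j)) ⟩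
    Σℚ (λ j → row (punchIn r i) j * y j + c * (row r j * y j))
      ≡⟨ Σ-+ (λ j → row (punchIn r i) j * y j) (λ j → c * (row r j * y j)) ⟩
    row (punchIn r i) · y + Σℚ (λ j → c * (row r j * y j))
      ≡⟨ cong (row (punchIn r i) · y +_) (Σ-*ˡ c (λ j → row r j * y j)) ⟩
    row (punchIn r i) · y + c * (row r · y)            ∎
    where
    c = - (A (punchIn r i) zero * 1/ π)
    distr : ∀ a c b y → (a + c * b) * y ≡ a * y + c * (b * y)
    distr = solve 4 (λ a c b y → (a :+ c :* b) :* y := a :* y :+ c :* (b :* y)) refl
  x-solves-r : A r · x ≡ 0ℚ
  x-solves-r = begin
    π * x₀ + row r · y                  ≡⟨ rearrange π (1/ π) (row r · y) ⟩
    row r · y - (π * 1/ π) * (row r · y)  ≡⟨ cong (λ t → row r · y - t * (row r · y)) (*-inverseʳ π) ⟩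
    row r · y - 1ℚ * (row r · y)          ≡⟨ cong (λ t → row r · y - t) (*-identityˡ (row r · y)) ⟩
    row r · y - row r · y                 ≡⟨ +-inverseʳ (row r · y) ⟩
    0ℚ ∎
    where
    rearrange : ∀ p q z → p * (- (q * z)) + z ≡ z + - ((p * q) * z)
    rearrange = solve 3 (λ p q z → p :* (:- (q :* z)) :+ z := z :+ :- ((p :* q) :* z)) refl
  x-solves-other : ∀ i → A (punchIn r i) · x ≡ 0ℚ
  x-solves-other i = begin
    a₀ * x₀ + row (punchIn r i) · y                   ≡⟨ rearrange a₀ (1/ π) (row r · y) (row (punchIn r i) · y) ⟩
    row (punchIn r i) · y + - (a₀ * 1/ π) * (row r · y)  ≡⟨ sym (reduced i) ⟩
    A′ i · y                                          ≡⟨ proj₂ (proj₂ solution) i ⟩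
    0ℚ ∎
    where
    a₀ = A (punchIn r i) zero
    rearrange : ∀ p q z w → p * (- (q * z)) + w ≡ w + - (p * q) * z
    rearrange = solve 4 (λ p q z w → p :* (:- (q :* z)) :+ w := w :+ :- (p :* q) :* z) refl
  x-solves : ∀ i → A i · x ≡ 0ℚ
  x-solves i with r Fin.≟ i
  ... | yes refl = x-solves-r
  ... | no r≢i   = subst (λ t → A t · x ≡ 0ℚ) (Finₚ.punchIn-punchOut r≢i) (x-solves-other (punchOut r≢i))

LinearlyIndependent : ∀ {k l} → (Fin k → Fin l → ℚ) → Set
LinearlyIndependent {k} p = ∀ (μ : Fin k → ℚ) → (∀ e → μ · (λ i → p i e) ≡ 0ℚ) → ∀ i → μ i ≡ 0ℚ

independent⇒≮ : ∀ {k l} (p : Fin k → Fin l → ℚ) → LinearlyIndependent p → ¬ (l ℕ.< k)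
independent⇒≮ p indep l<k with underdetermined l<k (λ e i → p i e)
... | μ , (i , μᵢ≢0) , solves = μᵢ≢0 (indep μ (λ e → trans (·-comm μ _) (solves e)) i)

-- A nonzero vector orthogonal to the points chosen so far yields the next one.
greedy-independent : ∀ {l} (P : (Fin l → ℚ) → Set) →
  (∀ b → NonZeroVector b → ∃ λ x → P x × b · x ≢ 0ℚ) →
  ∀ k → k ℕ.≤ l → Σ (Fin k → Fin l → ℚ) λ p → (∀ i → P (p i)) × LinearlyIndependent p
greedy-independent P detect zero    _   = (λ ()) , (λ ()) , λ _ _ ()
greedy-independent {l} P detect (suc k) k<l = q , q∈P , q-independent
  where
  open ≡-Reasoning
  previous = greedy-independent P detect k (ℕₚ.<⇒≤ k<l)
  p = proj₁ previous
  normal = underdetermined k<l p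
  b = proj₁ normal
  new = detect b (proj₁ (proj₂ normal))
  q : Fin (suc k) → Fin l → ℚ
  q zero    = proj₁ new
  q (suc i) = p i
  q∈P : ∀ i → P (q i)
  q∈P zero    = proj₁ (proj₂ new)
  q∈P (suc i) = proj₁ (proj₂ previous) i
  q-independent : LinearlyIndependent q
  q-independent μ vanishes = all
    where
    tail : Fin k → ℚ
    tail i = μ (suc i)
    -- Pairing the relation with `b` kills all earlier points and leaves `μ zero` times a nonzero
    -- number.
    head≡0 : μ zero ≡ 0ℚ
    head≡0 = *-cancel-0 (proj₂ (proj₂ new)) (begin
      μ zero * (b · q zero)                       ≡⟨ sym (+-identityʳ _) ⟩
      μ zero * (b · q zero) + 0ℚ                  ≡⟨ cong (μ zero * (b · q zero) +_) (sym (Σ-zero orth)) ⟩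
      μ · (λ i → b · q i)                         ≡⟨ sym (·-combination b μ q) ⟩
      b · (λ e → μ · (λ i → q i e))               ≡⟨ Σ-zero (λ e → trans (cong (b e *_) (vanishes e)) (*-zeroʳ (b e))) ⟩
      0ℚ ∎)
      where
      orth : ∀ i → μ (suc i) * (b · p i) ≡ 0ℚ
      orth i = trans (cong (μ (suc i) *_) (trans (·-comm b (p i)) (proj₂ (proj₂ normal) i))) (*-zeroʳ (μ (suc i)))
    tail-vanishes : ∀ e → tail · (λ i → p i e) ≡ 0ℚ
    tail-vanishes e = begin
      tail · (λ i → p i e)                        ≡⟨ sym (+-identityˡ _) ⟩
      0ℚ + tail · (λ i → p i e)
        ≡⟨ cong (_+ tail · (λ i → p i e)) (sym (trans (cong (_* q zero e) head≡0) (*-zeroˡ (q zero e)))) ⟩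
      μ · (λ i → q i e)                           ≡⟨ vanishes e ⟩
      0ℚ ∎
    all : ∀ i → μ i ≡ 0ℚ
    all zero    = head≡0
    all (suc i) = proj₂ (proj₂ previous) tail tail-vanishes i

-- Affine independence, dimension and facets

2≢0 : twoℚ ≢ 0ℚ
2≢0 ()

Σμ*c : ∀ {k} (μ : Fin k → ℚ) {f : Fin k → ℚ} {c} → (∀ i → f i ≡ c) → μ · f ≡ Σℚ μ * c
Σμ*c μ {f} {c} f≡c = trans (Σ-cong (λ i → trans (cong (μ i *_) (f≡c i)) (*-comm (μ i) c)))
                           (trans (Σ-*ˡ c μ) (*-comm c (Σℚ μ)))

-- Homogenisation: an extra coordinate 1 turns affine independence in dimension m into linear
-- independence in dimension m + 1.
dim-≤ : ∀ {m} {P : (Fin m → ℚ) → Set} → ¬ HasAffIndep P (suc (suc m))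
dim-≤ {m} (p , _ , affIndep) = independent⇒≮ lifted
  (λ μ vanishes → affIndep μ (trans (Σ-cong (λ i → sym (*-identityʳ (μ i)))) (vanishes zero))
                             (λ e → vanishes (suc e)))
  (s≤s (s≤s ℕₚ.≤-refl))
  where
  lifted : Fin (suc (suc m)) → Fin (suc m) → ℚ
  lifted i zero    = 1ℚ
  lifted i (suc e) = p i e

module _ {m : ℕ} (P : (Fin m → ℚ) → Set) (a : Fin m → ℚ) {β : ℚ} (β≢0 : β ≢ 0ℚ) where

  private
    OnFace : (Fin m → ℚ) → Set
    OnFace x = P x × a · x ≡ β

  combination≡0⇒Σ≡0 : ∀ {k} (p : Fin k → Fin m → ℚ) → (∀ i → a · p i ≡ β) → ∀ μ →
                      (∀ e → μ · (λ i → p i e) ≡ 0ℚ) → Σℚ μ ≡ 0ℚ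
  combination≡0⇒Σ≡0 p on μ vanishes = *-cancel-0 β≢0 (begin
    Σℚ μ * β                        ≡⟨ sym (Σμ*c μ on) ⟩
    μ · (λ i → a · p i)             ≡⟨ sym (·-combination a μ p) ⟩
    a · (λ e → μ · (λ i → p i e))   ≡⟨ Σ-zero (λ e → trans (cong (a e *_) (vanishes e)) (*-zeroʳ (a e))) ⟩
    0ℚ ∎)
    where open ≡-Reasoning

  -- Off the origin, affine and linear independence of points of a hyperplane agree.
  face-dim-≤ : ¬ HasAffIndep OnFace (suc m)
  face-dim-≤ (p , on , affIndep) = independent⇒≮ p
    (λ μ vanishes → affIndep μ (combination≡0⇒Σ≡0 p (λ i → proj₂ (on i)) μ vanishes) vanishes) (s≤s ℕₚ.≤-refl)

  -- Detection says that no nonzero `b` is orthogonal to the whole face, so the greedy choice finds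
  -- m independent points on it. The point `z` off the face adds one more, whence dimensions m - 1
  -- and m; writing m as `suc d` gives the former a name.
  facet-from-detection : (∀ x → P x → a · x ℚ.≤ β) →
    (∀ b → NonZeroVector b → ∃ λ x → OnFace x × b · x ≢ 0ℚ) →
    ∀ z → P z → a · z ≡ 0ℚ → (∃ λ d → m ≡ suc d) → DefinesFacet P a β
  facet-from-detection valid detect z z∈P az≡0 (d , refl) =
    valid , d , ((p , on , λ μ _ → p-indep μ) , face-dim-≤) , ((q , q∈P , q-indep) , dim-≤ {P = P})
    where
    open ≡-Reasoning
    points = greedy-independent OnFace detect m ℕₚ.≤-refl
    p = proj₁ points
    on = proj₁ (proj₂ points)
    p-indep = proj₂ (proj₂ points)
    q : Fin (suc m) → Fin m → ℚ
    q zero    = z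
    q (suc i) = p i
    q∈P : ∀ i → P (q i)
    q∈P zero    = z∈P
    q∈P (suc i) = proj₁ (on i)
    q-indep : AffinelyIndependent q
    q-indep μ Σμ≡0 vanishes = all
      where
      tail : Fin m → ℚ
      tail i = μ (suc i)
      -- Pairing with `a` kills `z` and takes the value β at every other point, so the other weights
      -- sum to zero; then so does the weight of `z`.
      Σtail≡0 : Σℚ tail ≡ 0ℚ
      Σtail≡0 = *-cancel-0 β≢0 (begin
        Σℚ tail * β                         ≡⟨ sym (Σμ*c tail (λ i → proj₂ (on i))) ⟩
        tail · (λ i → a · p i)              ≡⟨ sym (+-identityˡ _) ⟩
        0ℚ + tail · (λ i → a · p i)
          ≡⟨ cong (_+ tail · (λ i → a · p i)) (sym (trans (cong (μ zero *_) az≡0) (*-zeroʳ (μ zero)))) ⟩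
        μ · (λ i → a · q i)                 ≡⟨ sym (·-combination a μ q) ⟩
        a · (λ e → μ · (λ i → q i e))       ≡⟨ Σ-zero (λ e → trans (cong (a e *_) (vanishes e)) (*-zeroʳ (a e))) ⟩
        0ℚ ∎)
      head≡0 : μ zero ≡ 0ℚ
      head≡0 = trans (sym (+-identityʳ (μ zero))) (trans (cong (μ zero +_) (sym Σtail≡0)) Σμ≡0)
      tail-vanishes : ∀ e → tail · (λ i → p i e) ≡ 0ℚ
      tail-vanishes e = begin
        tail · (λ i → p i e)                ≡⟨ sym (+-identityˡ _) ⟩
        0ℚ + tail · (λ i → p i e)
          ≡⟨ cong (_+ tail · (λ i → p i e)) (sym (trans (cong (_* z e) head≡0) (*-zeroˡ (z e)))) ⟩
        μ · (λ i → q i e)                   ≡⟨ vanishes e ⟩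
        0ℚ ∎
      all : ∀ i → μ i ≡ 0ℚ
      all zero    = head≡0
      all (suc i) = p-indep tail tail-vanishes i

-- Menger's theorem

-- The predicate holds at every vertex of the path, so paths with mutually exclusive predicates are
-- vertex-disjoint.
data Path {V : Set} (_~_ : V → V → Set) (P : V → Set) : V → V → Set where
  [_]    : ∀ {u} → P u → Path _~_ P u u
  _∷⟨_⟩_ : ∀ {u v w} → P u → u ~ v → Path _~_ P v w → Path _~_ P u w

infixr 5 _∷⟨_⟩_

Symm : {V : Set} → (V → V → Set) → Set
Symm _~_ = ∀ {u v} → u ~ v → v ~ u

module _ {V : Set} {_~_ : V → V → Set} where

  source : ∀ {P u v} → Path _~_ P u v → P u
  source [ p ]        = p
  source (p ∷⟨ _ ⟩ _) = p

  target : ∀ {P u v} → Path _~_ P u v → P v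
  target [ p ]        = p
  target (_ ∷⟨ _ ⟩ π) = target π

  infixr 5 _++_
  _++_ : ∀ {P u v w} → Path _~_ P u v → Path _~_ P v w → Path _~_ P u w
  [ _ ]          ++ ρ = ρ
  (p ∷⟨ e ⟩ π) ++ ρ = p ∷⟨ e ⟩ (π ++ ρ)

  reverse : Symm _~_ → ∀ {P u v} → Path _~_ P u v → Path _~_ P v u
  reverse sy [ p ]        = [ p ]
  reverse sy (p ∷⟨ e ⟩ π) = reverse sy π ++ (source π ∷⟨ sy e ⟩ [ p ])

  mapPath : ∀ {_≈_ : V → V → Set} {P Q : V → Set} → (∀ {u v} → u ~ v → u ≈ v) → (∀ {u} → P u → Q u) →
            ∀ {u v} → Path _~_ P u v → Path _≈_ Q u v
  mapPath f g [ p ]        = [ g p ]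
  mapPath f g (p ∷⟨ e ⟩ π) = g p ∷⟨ f e ⟩ mapPath f g π

  -- The path is cut at its first vertex in `T`; before that, `Q` spreads from vertex to vertex by
  -- the assumption on vertices outside `T`.
  truncate : ∀ {P Q T : V → Set} → Decidable T →
             (∀ {u v} → Q u → ¬ T u → u ~ v → Q v) →
             ∀ {u v} → Path _~_ P u v → Q u → T v →
             ∃ λ s → T s × Path _~_ (λ x → P x × Q x) u s
  truncate T? keep [ p ] q t = _ , t , [ p , q ]
  truncate T? keep {u} (p ∷⟨ e ⟩ π) q t with T? u
  ... | yes tu = u , tu , [ p , q ]
  ... | no ¬tu with s , ts , ρ ← truncate T? keep π (keep q ¬tu e) t = s , ts , (p , q) ∷⟨ e ⟩ ρ

  crossing : ∀ {P Q : V → Set} → Decidable Q → ∀ {u v} → Path _~_ P u v → Q u → ¬ Q v →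
             ∃ λ x → ∃ λ y → P x × P y × Q x × ¬ Q y × x ~ y
  crossing Q? [ _ ] q ¬q = ⊥-elim (¬q q)
  crossing Q? {u} (_∷⟨_⟩_ {v = v} p e π) q ¬q with Q? v
  ... | yes qv = crossing Q? π qv ¬q
  ... | no ¬qv = u , v , p , source π , q , ¬qv , e

index-injective : ∀ {A : Set} {x y : A} {xs} (x∈ : x ∈ xs) (y∈ : y ∈ xs) → index x∈ ≡ index y∈ → x ≡ y
index-injective {xs = xs} x∈ y∈ eq = trans (lookup-index x∈) (trans (cong (List.lookup xs) eq) (sym (lookup-index y∈)))

-- Pigeonhole on `v` together with all `s i`: by injectivity of `s`, the collision must involve `v`.
injection-covers : ∀ {A : Set} {k} (s : Fin k → A) (xs : List A) → length xs ℕ.≤ k →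
                   (∀ i → s i ∈ xs) → (∀ i j → s i ≡ s j → i ≡ j) → ∀ {v} → v ∈ xs → ∃ λ i → s i ≡ v
injection-covers {k = k} s xs ≤k s∈ inj {v} v∈
  with Finₚ.pigeonhole (s≤s ≤k) f
  where
  f : Fin (suc k) → Fin (length xs)
  f zero    = index v∈
  f (suc i) = index (s∈ i)
... | zero  , suc j , _ , eq = j , index-injective (s∈ j) v∈ (sym eq)
... | suc i , suc j , i<j , eq =
  ⊥-elim (Finₚ.<⇒≢ i<j (cong suc (inj i j (index-injective (s∈ i) (s∈ j) eq))))

data Side : Set where
  left middle right : Side

_≟ˢ_ : (s t : Side) → Dec (s ≡ t)
left   ≟ˢ left   = yes refl
left   ≟ˢ middle = no λ ()
left   ≟ˢ right  = no λ ()
middle ≟ˢ left   = no λ ()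
middle ≟ˢ middle = yes refl
middle ≟ˢ right  = no λ ()
right  ≟ˢ left   = no λ ()
right  ≟ˢ middle = no λ ()
right  ≟ˢ right  = yes refl

not-extreme : ∀ {s} → s ≢ left → s ≢ right → s ≡ middle
not-extreme {left}   ¬l ¬r = ⊥-elim (¬l refl)
not-extreme {middle} ¬l ¬r = refl
not-extreme {right}  ¬l ¬r = ⊥-elim (¬r refl)

module _ {V : Set} (_~_ : V → V → Set) (A B : V → Set) (k : ℕ) where

  -- A separator given by labels instead of by the absence of paths: the middle vertices, fewer than
  -- k, are deleted, and no edge leads from left to right. The labels make it possible to glue two
  -- separations pointwise.
  record Separation : Set where
    field
      side      : V → Side
      cover     : List V
      small     : length cover ℕ.< k
      covers    : ∀ {v} → side v ≡ middle → v ∈ cover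
      A-side    : ∀ {v} → A v → side v ≢ right
      B-side    : ∀ {v} → B v → side v ≢ left
      separates : ∀ {u v} → u ~ v → side u ≡ left → side v ≢ right

  record Linkage : Set₁ where
    field
      class    : Fin k → V → Set
      disjoint : ∀ {i j v} → class i v → class j v → i ≡ j
      from to  : Fin k → V
      from∈    : ∀ i → A (from i)
      to∈      : ∀ i → B (to i)
      path     : ∀ i → Path _~_ (class i) (from i) (to i)

  Menger : Set₁
  Menger = Separation ⊎ Linkage

-- Göring's induction on the edges, for an edge xy that crosses a separation (left, middle, right):
-- separating A from middle ∪ {x}, or middle ∪ {y} from B, also separates A from B once xy is added;
-- otherwise the two linkages are joined through middle and xy.
module AddEdge {V : Set} (_≟_ : (u v : V) → Dec (u ≡ v)) {_~_ _≈_ : V → V → Set} (k : ℕ)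
  (~-sym : Symm _~_) (include : ∀ {u v} → u ~ v → u ≈ v)
  (x y : V) (x≈y : x ≈ y)
  (split : ∀ {u v} → u ≈ v → u ~ v ⊎ ((u ≡ x × v ≡ y) ⊎ (u ≡ y × v ≡ x)))
  (ih : ∀ {A B : V → Set} → Decidable A → Decidable B → Menger _~_ A B k)
  {A B : V → Set} (A? : Decidable A) (B? : Decidable B)
  (sep : Separation _~_ A B k) where

  open Separation sep

  module _ (x-left : side x ≡ left) (y-right : side y ≡ right) where

    A′ B′ : V → Set
    B′ v = side v ≡ middle ⊎ v ≡ x
    A′ v = side v ≡ middle ⊎ v ≡ y

    A′? : Decidable A′
    A′? v = (side v ≟ˢ middle) ⊎-dec (v ≟ y)
    B′? : Decidable B′
    B′? v = (side v ≟ˢ middle) ⊎-dec (v ≟ x)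

    left≢middle : ∀ {s} → s ≡ left → s ≢ middle
    left≢middle refl ()
    right≢middle : ∀ {s} → s ≡ right → s ≢ middle
    right≢middle refl ()

    -- The right side is kept from the old separation and the new labels are used elsewhere. An edge
    -- from new left to old right would start in the old middle or at `x`, but both belong to `B′`
    -- and are never left in the new separation.
    separation-A : Separation _~_ A B′ k → Separation _≈_ A B k
    separation-A sep₁ = record
      { side = λ v → pick (side v) (S.side v) ; cover = S.cover ; small = S.small
      ; covers = λ {v} eq → S.covers (pick-middle (side v) eq)
      ; A-side = λ {v} a → pick-A (side v) (A-side a) (S.A-side a)
      ; B-side = λ {v} b → pick-B (side v) (B-side b) (λ m → S.B-side (inj₁ m))
      ; separates = λ {u} {v} e → sepa u v (split e) }
      where
      module S = Separation sep₁
      pick : Side → Side → Side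
      pick right _ = right
      pick _     t = t
      pick-middle : ∀ s {t} → pick s t ≡ middle → t ≡ middle
      pick-middle left   eq = eq
      pick-middle middle eq = eq
      pick-A : ∀ s {t} → s ≢ right → t ≢ right → pick s t ≢ right
      pick-A left   _ t≢ = t≢
      pick-A middle _ t≢ = t≢
      pick-A right  s≢ _ = λ _ → s≢ refl
      pick-B : ∀ s {t} → s ≢ left → (s ≡ middle → t ≢ left) → pick s t ≢ left
      pick-B left   s≢ _ = λ _ → s≢ refl
      pick-B middle _  f = f refl
      pick-B right  _  _ = λ ()
      pick-left : ∀ s {t} → pick s t ≡ left → s ≢ right × t ≡ left
      pick-left left   eq = (λ ()) , eq
      pick-left middle eq = (λ ()) , eq
      pick-right : ∀ s {t} → pick s t ≡ right → s ≡ right ⊎ t ≡ right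
      pick-right left   eq = inj₂ eq
      pick-right middle eq = inj₂ eq
      pick-right right  eq = inj₁ refl
      not-left : ∀ {v} → B′ v → pick (side v) (S.side v) ≢ left
      not-left {v} b eq = S.B-side b (proj₂ (pick-left (side v) eq))
      sepa : ∀ u v → u ~ v ⊎ ((u ≡ x × v ≡ y) ⊎ (u ≡ y × v ≡ x)) →
             pick (side u) (S.side u) ≡ left → pick (side v) (S.side v) ≢ right
      sepa u v (inj₁ e) eq eq′ with pick-left (side u) eq | pick-right (side v) eq′
      ... | u≢r , ul | inj₂ vr = S.separates e ul vr
      ... | u≢r , ul | inj₁ vr with side u in side-u
      ...   | left   = separates e side-u vr
      ...   | middle = S.B-side (inj₁ side-u) ul
      ...   | right  = u≢r refl
      sepa u v (inj₂ (inj₁ (refl , refl))) eq eq′ = not-left (inj₂ refl) eq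
      sepa u v (inj₂ (inj₂ (refl , refl))) eq eq′ = proj₁ (pick-left (side u) eq) y-right

    -- The mirror image: the old left side is kept, and the new labels are used on the middle and
    -- the right.
    separation-B : Separation _~_ A′ B k → Separation _≈_ A B k
    separation-B sep₂ = record
      { side = λ v → pick (side v) (S.side v) ; cover = S.cover ; small = S.small
      ; covers = λ {v} eq → S.covers (pick-middle (side v) eq)
      ; A-side = λ {v} a → pick-A (side v) (A-side a) (λ m → S.A-side (inj₁ m))
      ; B-side = λ {v} b → pick-B (side v) (B-side b) (S.B-side b)
      ; separates = λ {u} {v} e → sepa u v (split e) }
      where
      module S = Separation sep₂
      pick : Side → Side → Side
      pick left _ = left
      pick _    t = t
      pick-middle : ∀ s {t} → pick s t ≡ middle → t ≡ middle
      pick-middle right  eq = eq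
      pick-middle middle eq = eq
      pick-A : ∀ s {t} → s ≢ right → (s ≡ middle → t ≢ right) → pick s t ≢ right
      pick-A left   _ _ = λ ()
      pick-A middle _ f = f refl
      pick-A right  s≢ _ = λ _ → s≢ refl
      pick-B : ∀ s {t} → s ≢ left → t ≢ left → pick s t ≢ left
      pick-B left   s≢ _ = λ _ → s≢ refl
      pick-B middle _ t≢ = t≢
      pick-B right  _ t≢ = t≢
      pick-left : ∀ s {t} → pick s t ≡ left → s ≡ left ⊎ t ≡ left
      pick-left left   eq = inj₁ refl
      pick-left middle eq = inj₂ eq
      pick-left right  eq = inj₂ eq
      pick-right : ∀ s {t} → pick s t ≡ right → s ≢ left × t ≡ right
      pick-right middle eq = (λ ()) , eq
      pick-right right  eq = (λ ()) , eq
      sepa : ∀ u v → u ~ v ⊎ ((u ≡ x × v ≡ y) ⊎ (u ≡ y × v ≡ x)) →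
             pick (side u) (S.side u) ≡ left → pick (side v) (S.side v) ≢ right
      sepa u v (inj₁ e) eq eq′ with pick-left (side u) eq | pick-right (side v) eq′
      ... | inj₂ ul | v≢l , vr = S.separates e ul vr
      ... | inj₁ ul | v≢l , vr with side v in side-v
      ...   | left   = v≢l refl
      ...   | middle = S.A-side (inj₁ side-v) vr
      ...   | right  = separates e ul side-v
      sepa u v (inj₂ (inj₁ (refl , refl))) eq eq′ = S.A-side (inj₂ refl) (proj₂ (pick-right (side v) eq′))
      sepa u v (inj₂ (inj₂ (refl , refl))) eq eq′ = proj₁ (pick-right (side v) eq′) x-left

    module Join (link₁ : Linkage _~_ A B′ k) (link₂ : Linkage _~_ A′ B k) where
      module K = Linkage link₁
      module L = Linkage link₂

      -- Without the edge xy, a path from `A` can enter the right side only through the middle, so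
      -- its part up to the first vertex of `B′` stays off the right side.
      trunc₁ : ∀ i → ∃ λ s → B′ s × Path _~_ (λ v → K.class i v × side v ≢ right) (K.from i) s
      trunc₁ i = truncate B′? keep (K.path i) (A-side (K.from∈ i)) (K.to∈ i)
        where
        keep : ∀ {u v} → side u ≢ right → ¬ B′ u → u ~ v → side v ≢ right
        keep {u} u≢r ¬b e with side u in eq
        ... | left   = separates e eq
        ... | middle = ⊥-elim (¬b (inj₁ refl))
        ... | right  = ⊥-elim (u≢r refl)

      trunc₂ : ∀ i → ∃ λ s → A′ s × Path _~_ (λ v → L.class i v × side v ≢ left) (L.to i) s
      trunc₂ i = truncate A′? keep (reverse ~-sym (L.path i)) (B-side (L.to∈ i)) (L.from∈ i)
        where
        keep : ∀ {u v} → side u ≢ left → ¬ A′ u → u ~ v → side v ≢ left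
        keep {u} u≢l ¬a e vl with side u in eq
        ... | right  = separates (~-sym e) vl eq
        ... | middle = ¬a (inj₁ refl)
        ... | left   = u≢l refl

      s : Fin k → V
      s i = proj₁ (trunc₁ i)
      t : Fin k → V
      t i = proj₁ (trunc₂ i)

      s∈ : ∀ i → K.class i (s i)
      s∈ i = proj₁ (target (proj₂ (proj₂ (trunc₁ i))))
      t∈ : ∀ i → L.class i (t i)
      t∈ i = proj₁ (target (proj₂ (proj₂ (trunc₂ i))))

      in-cover : ∀ {z v} → side v ≡ middle ⊎ v ≡ z → v ∈ z ∷ cover
      in-cover (inj₁ m)  = there (covers m)
      in-cover (inj₂ eq) = here eq

      -- The k truncated paths end at distinct vertices of `x ∷ cover`, a list of at most k entries,
      -- so every entry is such an end.
      s-covers : ∀ {v} → v ∈ x ∷ cover → ∃ λ i → s i ≡ v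
      s-covers = injection-covers s (x ∷ cover) small (λ i → in-cover (proj₁ (proj₂ (trunc₁ i))))
        (λ i j eq → K.disjoint (s∈ i) (subst (K.class j) (sym eq) (s∈ j)))
      t-covers : ∀ {v} → v ∈ y ∷ cover → ∃ λ i → t i ≡ v
      t-covers = injection-covers t (y ∷ cover) small (λ i → in-cover (proj₁ (proj₂ (trunc₂ i))))
        (λ i j eq → L.disjoint (t∈ i) (subst (L.class j) (sym eq) (t∈ j)))

      exit : ∀ i → ∃ λ s′ → A′ s′ × ((side (s i) ≡ middle × s′ ≡ s i) ⊎ (s i ≡ x × s′ ≡ y))
      exit i with proj₁ (proj₂ (trunc₁ i))
      ... | inj₁ m  = s i , inj₁ m , inj₁ (m , refl)
      ... | inj₂ eq = y , inj₂ refl , inj₂ (eq , refl)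

      -- The path of the second linkage that takes over: it starts at the middle vertex where path i
      -- ended, or at `y` if path i ended at `x`.
      τ : Fin k → Fin k
      τ i = proj₁ (t-covers (in-cover (proj₁ (proj₂ (exit i)))))
      t-τ : ∀ i → t (τ i) ≡ proj₁ (exit i)
      t-τ i = proj₂ (t-covers (in-cover (proj₁ (proj₂ (exit i)))))

      s-injective : ∀ {i j} → s i ≡ s j → i ≡ j
      s-injective {i} {j} eq = K.disjoint (s∈ i) (subst (K.class j) (sym eq) (s∈ j))

      τ-injective : ∀ {i j} → τ i ≡ τ j → i ≡ j
      τ-injective {i} {j} eq
        with proj₂ (proj₂ (exit i)) | proj₂ (proj₂ (exit j)) | trans (sym (t-τ i)) (trans (cong t eq) (t-τ j))
      ... | inj₁ (_ , p) | inj₁ (_ , q) | r = s-injective (trans (sym p) (trans r q))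
      ... | inj₂ (p , _) | inj₂ (q , _) | r = s-injective (trans p (sym q))
      ... | inj₁ (m , p) | inj₂ (_ , q) | r =
        ⊥-elim (right≢middle y-right (subst (λ v → side v ≡ middle) (trans (sym p) (trans r q)) m))
      ... | inj₂ (_ , p) | inj₁ (m , q) | r =
        ⊥-elim (right≢middle y-right (subst (λ v → side v ≡ middle) (trans (sym q) (trans (sym r) p)) m))

      class : Fin k → V → Set
      class i v = (K.class i v × side v ≢ right) ⊎ (L.class (τ i) v × side v ≢ left)

      -- Every middle vertex is the end of some truncated path, hence of the only one whose class
      -- contains it. First and second halves can share only middle vertices, so they meet only
      -- where they are joined.
      middle-class : ∀ {i v} → side v ≡ middle → K.class i v → L.class (τ i) v
      middle-class {i} {v} m c with i′ , refl ← s-covers (there (covers m)) with refl ← K.disjoint c (s∈ i′)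
        with proj₂ (proj₂ (exit i))
      ... | inj₁ (_ , p) = subst (L.class (τ i)) (trans (t-τ i) p) (t∈ (τ i))
      ... | inj₂ (p , _) = ⊥-elim (left≢middle x-left (subst (λ v → side v ≡ middle) p m))

      mixed : ∀ {i j v} → K.class i v → side v ≢ right → L.class (τ j) v → side v ≢ left → i ≡ j
      mixed c ¬r d ¬l = τ-injective (L.disjoint (middle-class (not-extreme ¬l ¬r) c) d)

      disjoint : ∀ {i j v} → class i v → class j v → i ≡ j
      disjoint (inj₁ (c , _))  (inj₁ (d , _))  = K.disjoint c d
      disjoint (inj₂ (c , _))  (inj₂ (d , _))  = τ-injective (L.disjoint c d)
      disjoint (inj₁ (c , ¬r)) (inj₂ (d , ¬l)) = mixed c ¬r d ¬l
      disjoint (inj₂ (c , ¬l)) (inj₁ (d , ¬r)) = sym (mixed d ¬r c ¬l)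

      first : ∀ i → Path _≈_ (class i) (K.from i) (s i)
      first i = mapPath include inj₁ (proj₂ (proj₂ (trunc₁ i)))
      second : ∀ i → Path _≈_ (class i) (t (τ i)) (L.to (τ i))
      second i = mapPath include inj₂ (reverse ~-sym (proj₂ (proj₂ (trunc₂ (τ i)))))

      path : ∀ i → Path _≈_ (class i) (K.from i) (L.to (τ i))
      path i with proj₂ (proj₂ (exit i))
      ... | inj₁ (_ , p) = first i ++ subst (λ v → Path _≈_ (class i) v (L.to (τ i))) (trans (t-τ i) p) (second i)
      ... | inj₂ (p , q) = first i ++ (target (first i) ∷⟨ subst₂ _≈_ (sym p) (sym (trans (t-τ i) q)) x≈y ⟩ second i)

      linkage : Linkage _≈_ A B k
      linkage = record
        { class = class ; disjoint = disjoint ; from = K.from ; to = λ i → L.to (τ i)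
        ; from∈ = K.from∈ ; to∈ = λ i → L.to∈ (τ i) ; path = path }

    addCrossingEdge : Menger _≈_ A B k
    addCrossingEdge with ih A? B′? | ih A′? B?
    ... | inj₁ sep₁  | _          = inj₁ (separation-A sep₁)
    ... | inj₂ _     | inj₁ sep₂  = inj₁ (separation-B sep₂)
    ... | inj₂ link₁ | inj₂ link₂ = inj₂ (Join.linkage link₁ link₂)

weakenLinkage : ∀ {V : Set} {_~_ _≈_ : V → V → Set} {A B k} → (∀ {u v} → u ~ v → u ≈ v) →
                Linkage _~_ A B k → Linkage _≈_ A B k
weakenLinkage f ℓ = record
  { class = class ; disjoint = disjoint ; from = from ; to = to ; from∈ = from∈ ; to∈ = to∈
  ; path = λ i → mapPath f id (path i) }
  where open Linkage ℓ

module _ {n : ℕ} where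

  AdjacentIn : List (Fin n × Fin n) → Fin n → Fin n → Set
  AdjacentIn E u v = ((u , v) ∈ E) ⊎ ((v , u) ∈ E)

  AdjacentIn-sym : ∀ {E} → Symm (AdjacentIn E)
  AdjacentIn-sym (inj₁ e) = inj₂ e
  AdjacentIn-sym (inj₂ e) = inj₁ e

  AdjacentIn-there : ∀ {e E u v} → AdjacentIn E u v → AdjacentIn (e ∷ E) u v
  AdjacentIn-there (inj₁ e∈) = inj₁ (there e∈)
  AdjacentIn-there (inj₂ e∈) = inj₂ (there e∈)

  lookup-injective : ∀ {xs : List (Fin n)} → Unique xs → ∀ i j → List.lookup xs i ≡ List.lookup xs j → i ≡ j
  lookup-injective {_ ∷ _} (_ ∷ _)  zero    zero    _  = refl
  lookup-injective {_ ∷ xs} (px ∷ _) zero   (suc j) eq = ⊥-elim (All.lookup px (∈-lookup j) eq)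
  lookup-injective {_ ∷ xs} (px ∷ _) (suc i) zero   eq = ⊥-elim (All.lookup px (∈-lookup i) (sym eq))
  lookup-injective {_ ∷ _} (_ ∷ u)  (suc i) (suc j) eq = cong suc (lookup-injective u i j eq)

  -- Induction on the edges. Without edges, the common vertices of `A` and `B` either form a small
  -- separator or supply k one-vertex paths. A further edge preserves linkages, and it preserves a
  -- separation unless it joins left to right.
  menger : ∀ k (E : List (Fin n × Fin n)) {A B : Fin n → Set} → Decidable A → Decidable B →
           Menger (AdjacentIn E) A B k
  menger k [] {A} {B} A? B? with length common ℕ.<? k
    where
    common = filter (λ v → A? v ×-dec B? v) (allFin n)
  ... | yes <k = inj₁ (record
    { side = side ; cover = filter (λ v → A? v ×-dec B? v) (allFin n) ; small = <k
    ; covers = λ {v} m → ∈-filter⁺ (λ v → A? v ×-dec B? v) (∈-allFin v) (is-middle v m)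
    ; A-side = λ {v} → not-right v ; B-side = λ {v} → not-left v ; separates = λ { (inj₁ ()) ; (inj₂ ()) } })
    where
    side : Fin n → Side
    side v with A? v | B? v
    ... | yes _ | yes _ = middle
    ... | yes _ | no _  = left
    ... | no _  | _     = right
    is-middle : ∀ v → side v ≡ middle → A v × B v
    is-middle v eq with A? v | B? v
    ... | yes a | yes b = a , b
    is-middle v () | yes _ | no _
    is-middle v () | no _ | _
    not-right : ∀ v → A v → side v ≢ right
    not-right v a eq with A? v | B? v
    ... | no ¬a | _ = ¬a a
    not-right v a () | yes _ | yes _
    not-right v a () | yes _ | no _
    not-left : ∀ v → B v → side v ≢ left
    not-left v b eq with A? v | B? v
    ... | yes _ | no ¬b = ¬b b
    not-left v b () | yes _ | yes _
    not-left v b () | no _ | _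
  ... | no ≮k = inj₂ (record
    { class = λ i v → v ≡ pt i
    ; disjoint = λ p q → Finₚ.inject≤-injective _ _ _ _ (lookup-injective uniq _ _ (trans (sym p) q))
    ; from = pt ; to = pt ; from∈ = λ i → proj₁ (in-both i) ; to∈ = λ i → proj₂ (in-both i) ; path = λ i → [ refl ] })
    where
    common = filter (λ v → A? v ×-dec B? v) (allFin n)
    uniq : Unique common
    uniq = filter⁺ (λ v → A? v ×-dec B? v) (allFin⁺ n)
    pt : Fin k → Fin n
    pt i = List.lookup common (inject≤ i (ℕₚ.≮⇒≥ ≮k))
    in-both : ∀ i → A (pt i) × B (pt i)
    in-both i = proj₂ (∈-filter⁻ (λ v → A? v ×-dec B? v) {xs = allFin n} (∈-lookup {xs = common} (inject≤ i (ℕₚ.≮⇒≥ ≮k))))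
  menger k ((x , y) ∷ E) {A} {B} A? B? with menger k E A? B?
  ... | inj₂ ℓ = inj₂ (weakenLinkage AdjacentIn-there ℓ)
  ... | inj₁ sep = addEdge
    where
    open Separation sep
    open AddEdge Fin._≟_ {AdjacentIn E} {AdjacentIn ((x , y) ∷ E)} k AdjacentIn-sym AdjacentIn-there
    split : ∀ {u v} → AdjacentIn ((x , y) ∷ E) u v → AdjacentIn E u v ⊎ ((u ≡ x × v ≡ y) ⊎ (u ≡ y × v ≡ x))
    split (inj₁ (here refl)) = inj₂ (inj₁ (refl , refl))
    split (inj₁ (there e))   = inj₁ (inj₁ e)
    split (inj₂ (here refl)) = inj₂ (inj₂ (refl , refl))
    split (inj₂ (there e))   = inj₁ (inj₂ e)
    keep : ¬ (side x ≡ left × side y ≡ right) → ¬ (side y ≡ left × side x ≡ right) →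
           Menger (AdjacentIn ((x , y) ∷ E)) A B k
    keep ¬xy ¬yx = inj₁ (record
      { side = side ; cover = cover ; small = small ; covers = covers ; A-side = A-side ; B-side = B-side
      ; separates = λ e → sepa (split e) })
      where
      sepa : ∀ {u v} → AdjacentIn E u v ⊎ ((u ≡ x × v ≡ y) ⊎ (u ≡ y × v ≡ x)) → side u ≡ left → side v ≢ right
      sepa (inj₁ e)                    l r = separates e l r
      sepa (inj₂ (inj₁ (refl , refl))) l r = ¬xy (l , r)
      sepa (inj₂ (inj₂ (refl , refl))) l r = ¬yx (l , r)
    swap : ∀ {X Y Z : Set} → X ⊎ (Y ⊎ Z) → X ⊎ (Z ⊎ Y)
    swap (inj₁ a)        = inj₁ a
    swap (inj₂ (inj₁ b)) = inj₂ (inj₂ b)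
    swap (inj₂ (inj₂ c)) = inj₂ (inj₁ c)
    addEdge : Menger (AdjacentIn ((x , y) ∷ E)) A B k
    addEdge with (side x ≟ˢ left) ×-dec (side y ≟ˢ right) | (side y ≟ˢ left) ×-dec (side x ≟ˢ right)
    ... | yes (p , q) | _ = addCrossingEdge x y (inj₁ (here refl)) split (menger k E) A? B? sep p q
    ... | no _ | yes (p , q) = addCrossingEdge y x (inj₂ (here refl)) (λ e → swap (split e)) (menger k E) A? B? sep p q
    ... | no ¬xy | no ¬yx = keep ¬xy ¬yx

-- Bonds and the cycle

indicator : Bool → ℚ
indicator true  = 1ℚ
indicator false = 0ℚ

xor-comm : ∀ a b → a xor b ≡ b xor a
xor-comm false false = refl
xor-comm false true  = refl
xor-comm true  false = refl
xor-comm true  true  = refl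

Alternating : ∀ {k} → (Fin k → Bool) → Set
Alternating g = ∃ λ i₁ → ∃ λ i₂ → ∃ λ i₃ → ∃ λ i₄ → i₁ Fin.< i₂ × i₂ Fin.< i₃ × i₃ Fin.< i₄ ×
  g i₂ ≡ not (g i₁) × g i₃ ≡ g i₁ × g i₄ ≡ not (g i₁)

changes : ∀ {k} → (Fin (suc k) → Bool) → ℚ
changes {k} g = Σℚ (λ (i : Fin k) → indicator (g (inject₁ i) xor g (suc i)))

-- Sequences classified by their number of maximal constant runs. Positions inside the runs are
-- remembered so that prepending an opposite value can produce an alternation; the last value tells
-- whether closing the sequence into a cycle adds a change.
data Runs {k} (g : Fin (suc k) → Bool) : Set where
  one   : (∀ i → g i ≡ g zero) → changes g ≡ 0ℚ → Runs g
  two   : ∀ i → zero {k} Fin.< i → g i ≡ not (g zero) → g (fromℕ k) ≡ not (g zero) → changes g ≡ 1ℚ → Runs g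
  three : ∀ i j → zero {k} Fin.< i → i Fin.< j → g i ≡ not (g zero) → g j ≡ g zero → g (fromℕ k) ≡ g zero →
          changes g ≡ twoℚ → Runs g
  more  : Alternating g → Runs g

≢⇒≡not : ∀ {a b : Bool} → a ≢ b → a ≡ not b
≢⇒≡not {false} {false} ne = ⊥-elim (ne refl)
≢⇒≡not {false} {true}  ne = refl
≢⇒≡not {true}  {false} ne = refl
≢⇒≡not {true}  {true}  ne = ⊥-elim (ne refl)

indicator-same : ∀ {a b} → b ≡ a → indicator (a xor b) ≡ 0ℚ
indicator-same {false} refl = refl
indicator-same {true}  refl = refl

indicator-differ : ∀ {a b} → b ≡ not a → indicator (a xor b) ≡ 1ℚ
indicator-differ {false} refl = refl
indicator-differ {true}  refl = refl

runs : ∀ {k} (g : Fin (suc k) → Bool) → Runs g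
runs {zero}  g = one (λ { zero → refl }) refl
runs {suc k} g with g (suc zero) Boolₚ.≟ g zero | runs (g ∘ suc)
... | yes same | one all ch =
  one (λ { zero → refl ; (suc i) → trans (all i) same }) (cong₂ _+_ (indicator-same same) ch)
... | yes same | two i 0<i gi gl ch =
  two (suc i) (s≤s z≤n) (trans gi (cong not same)) (trans gl (cong not same))
    (cong₂ _+_ (indicator-same same) ch)
... | yes same | three i j 0<i i<j gi gj gl ch =
  three (suc i) (suc j) (s≤s z≤n) (s≤s i<j) (trans gi (cong not same)) (trans gj same) (trans gl same)
    (cong₂ _+_ (indicator-same same) ch)
... | yes _ | more (i₁ , i₂ , i₃ , i₄ , p , q , r , alt) =
  more (suc i₁ , suc i₂ , suc i₃ , suc i₄ , s≤s p , s≤s q , s≤s r , alt)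
... | no ne | tail = continue tail
  where
  differ : g (suc zero) ≡ not (g zero)
  differ = ≢⇒≡not ne
  back : ∀ {b} → b ≡ not (g (suc zero)) → b ≡ g zero
  back eq = trans eq (trans (cong not differ) (Boolₚ.not-involutive (g zero)))
  continue : Runs (g ∘ suc) → Runs g
  continue (one all ch) =
    two (suc zero) (s≤s z≤n) differ (trans (all (fromℕ k)) differ) (cong₂ _+_ (indicator-differ differ) ch)
  continue (two i 0<i gi gl ch) =
    three (suc zero) (suc i) (s≤s z≤n) (s≤s 0<i) differ (back gi) (back gl)
      (cong₂ _+_ (indicator-differ differ) ch)
  continue (three i j 0<i i<j gi gj gl ch) =
    more (zero , suc zero , suc i , suc j , s≤s z≤n , s≤s 0<i , s≤s i<j , differ , back gi , trans gj differ)
  continue (more (i₁ , i₂ , i₃ , i₄ , p , q , r , alt)) =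
    more (suc i₁ , suc i₂ , suc i₃ , suc i₄ , s≤s p , s≤s q , s≤s r , alt)

module _ (G : Graph) where
  open Graph G

  nextF-cases : ∀ {k} (i : Fin (suc k)) →
                toℕ (nextF G i) ≡ suc (toℕ i) ⊎ (toℕ i ≡ k × nextF G i ≡ zero)
  nextF-cases {k} i with toℕ i ℕ.<? k
  ... | yes i<k = inj₁ (trans (Finₚ.toℕ-fromℕ< (m%n<n (suc (toℕ i)) (suc k))) (m<n⇒m%n≡m (s≤s i<k)))
  ... | no i≮k  = inj₂ (i≡k , Finₚ.toℕ-injective (trans (Finₚ.toℕ-fromℕ< (m%n<n (suc (toℕ i)) (suc k)))
                     (trans (cong (λ j → suc j % suc k) i≡k) (n%n≡0 (suc k)))))
    where i≡k = ℕₚ.≤-antisym (ℕ.s≤s⁻¹ (Finₚ.toℕ<n i)) (ℕₚ.≮⇒≥ i≮k)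

  cyclic-changes : ∀ {k} (g : Fin (suc k) → Bool) → 
    Σℚ (λ i → indicator (g i xor g (nextF G i))) ≡ changes g + indicator (g (fromℕ k) xor g zero)
  cyclic-changes {k} g = trans (Σ-last (λ i → indicator (g i xor g (nextF G i))))
    (cong₂ _+_ (Σ-cong (λ i → cong (λ j → indicator (g (inject₁ i) xor g j)) (next-inject i)))
               (cong (λ j → indicator (g (fromℕ k) xor g j)) next-last))
    where
    next-inject : ∀ (i : Fin k) → nextF G (inject₁ i) ≡ suc i
    next-inject i with nextF-cases (inject₁ i)
    ... | inj₁ eq = Finₚ.toℕ-injective (trans eq (cong suc (Finₚ.toℕ-inject₁ i)))
    ... | inj₂ (eq , _) = ⊥-elim (ℕₚ.<⇒≢ (Finₚ.toℕ<n i) (trans (sym (Finₚ.toℕ-inject₁ i)) eq))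
    next-last : nextF G (fromℕ k) ≡ zero
    next-last with nextF-cases (fromℕ k)
    ... | inj₁ eq = ⊥-elim (ℕₚ.<⇒≢ (Finₚ.toℕ<n (nextF G (fromℕ k))) (trans eq (cong suc (Finₚ.toℕ-fromℕ k))))
    ... | inj₂ (_ , eq) = eq

  -- Closing the sequence adds a change exactly when its ends differ, which turns the linear counts
  -- 0, 1, 2 into 0, 2, 2.
  cyclic-changes-0-or-2 : ∀ {k} (g : Fin (suc k) → Bool) → ¬ Alternating g →
    ((∀ i → g i ≡ g zero) × Σℚ (λ i → indicator (g i xor g (nextF G i))) ≡ 0ℚ) ⊎
    Σℚ (λ i → indicator (g i xor g (nextF G i))) ≡ twoℚ
  cyclic-changes-0-or-2 {k} g ¬alt with runs g
  ... | one all ch = inj₁ (all , trans (cyclic-changes g) (cong₂ _+_ ch (indicator-same (sym (all (fromℕ k))))))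
  ... | two _ _ _ gl ch = inj₂ (trans (cyclic-changes g)
    (cong₂ _+_ ch (trans (cong indicator (xor-comm _ (g zero))) (indicator-differ gl))))
  ... | three _ _ _ _ _ _ gl ch = inj₂ (trans (cyclic-changes g) (cong₂ _+_ ch (indicator-same (sym gl))))
  ... | more alt = ⊥-elim (¬alt alt)

  -- Adjacency, paths and the two sides of a bond

  Edge : (Fin m → Set) → Fin n → Fin n → Set
  Edge ok u v = ∃ λ e → Joins G e u v × ok e

  _~_ : Fin n → Fin n → Set
  _~_ = Edge (anyEdge G)

  Joins-sym : ∀ {e u v} → Joins G e u v → Joins G e v u
  Joins-sym (inj₁ p) = inj₂ p
  Joins-sym (inj₂ p) = inj₁ p

  Edge-sym : ∀ {ok} → Symm (Edge ok)
  Edge-sym (e , j , o) = e , Joins-sym j , o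

  Joins-unique : ∀ {e u v u′ v′} → Joins G e u v → Joins G e u′ v′ → (u ≡ u′ × v ≡ v′) ⊎ (u ≡ v′ × v ≡ u′)
  Joins-unique (inj₁ p) (inj₁ q) with refl ← trans (sym p) q = inj₁ (refl , refl)
  Joins-unique (inj₁ p) (inj₂ q) with refl ← trans (sym p) q = inj₂ (refl , refl)
  Joins-unique (inj₂ p) (inj₁ q) with refl ← trans (sym p) q = inj₂ (refl , refl)
  Joins-unique (inj₂ p) (inj₂ q) with refl ← trans (sym p) q = inj₁ (refl , refl)

  ordered : ∀ {e u v} → ends e ≡ (u , v) → u Fin.< v
  ordered {e} eq = subst (λ r → proj₁ r Fin.< proj₂ r) eq (noLoop e)

  Joins⇒≢ : ∀ {e u v} → Joins G e u v → u ≢ v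
  Joins⇒≢ (inj₁ p) refl = Finₚ.<-irrefl refl (ordered p)
  Joins⇒≢ (inj₂ p) refl = Finₚ.<-irrefl refl (ordered p)

  walk⇒path : ∀ {okV okE u v} → Walk G okV okE u v → Path (Edge okE) okV u v
  walk⇒path {okV} {okE} w = subst₂ (Path (Edge okE) okV) start stop (go len vert vOk step)
    where
    open Walk w
    go : ∀ l (x : Fin (suc l) → Fin n) → (∀ i → okV (x i)) →
         (∀ i → Edge okE (x (inject₁ i)) (x (suc i))) → Path (Edge okE) okV (x zero) (x (fromℕ l))
    go zero    x ok st = [ ok zero ]
    go (suc l) x ok st = ok zero ∷⟨ st zero ⟩ go l (x ∘ suc) (ok ∘ suc) (st ∘ suc)

  path⇒walk : ∀ {okV okE u v} → Path (Edge okE) okV u v → Walk G okV okE u v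
  path⇒walk {u = u} [ p ] = record
    { len = 0 ; vert = λ _ → u ; start = refl ; stop = refl ; vOk = λ _ → p ; step = λ () }
  path⇒walk {okV} {okE} {u} (_∷⟨_⟩_ {v = x} p e π) = record
    { len = suc len ; vert = vert′ ; start = refl ; stop = stop
    ; vOk = λ { zero → p ; (suc i) → vOk i }
    ; step = λ { zero → subst (Edge okE u) (sym start) e ; (suc i) → step i } }
    where
    open Walk (path⇒walk π)
    vert′ : Fin (suc (suc len)) → Fin n
    vert′ zero    = u
    vert′ (suc i) = vert i

  Connected : (Fin n → Set) → Set
  Connected P = ∀ u v → P u → P v → Path _~_ P u v

  -- Both sides are indexed by a Boolean, so that an argument about one side and its opposite need
  -- not distinguish the set from its complement.
  record Bond (h : Fin n → Bool) : Set where
    field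
      point     : ∀ β → ∃ λ v → h v ≡ β
      connected : ∀ β → Connected (λ v → h v ≡ β)

  ∈⇒lookup : ∀ {S : Subset n} {v} → v Subset.∈ S → lookup S v ≡ true
  ∈⇒lookup = Vecₚ.[]=⇒lookup

  lookup⇒∈ : ∀ {S : Subset n} {v} → lookup S v ≡ true → v Subset.∈ S
  lookup⇒∈ {S} {v} = Vecₚ.lookup⇒[]= v S

  ∈∁⇒lookup : ∀ {S : Subset n} {v} → v Subset.∈ ∁ S → lookup S v ≡ false
  ∈∁⇒lookup {S} {v} v∈ with lookup S v in eq
  ... | false = refl
  ... | true  = ⊥-elim (Subsetₚ.x∈∁p⇒x∉p v∈ (lookup⇒∈ eq))

  lookup⇒∈∁ : ∀ {S : Subset n} {v} → lookup S v ≡ false → v Subset.∈ ∁ S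
  lookup⇒∈∁ {S} {v} eq = Subsetₚ.x∉p⇒x∈∁p λ v∈ → case (trans (sym (∈⇒lookup v∈)) eq)
    where case : true ≢ false
          case ()

  isBond⇒bond : ∀ {S} → IsBond G S → Bond (lookup S)
  isBond⇒bond {S} ((( u , u∈) , cS) , ((w , w∈) , cT)) = record { point = point ; connected = connected }
    where
    point : ∀ β → ∃ λ v → lookup S v ≡ β
    point true  = u , ∈⇒lookup u∈
    point false = w , ∈∁⇒lookup w∈
    connected : ∀ β → Connected (λ v → lookup S v ≡ β)
    connected true  u v p q = mapPath id ∈⇒lookup (walk⇒path (cS u v (lookup⇒∈ p) (lookup⇒∈ q)))
    connected false u v p q = mapPath id ∈∁⇒lookup (walk⇒path (cT u v (lookup⇒∈∁ p) (lookup⇒∈∁ q)))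

  bond⇒isBond : ∀ {h} → Bond h → IsBond G (Vec.tabulate h)
  bond⇒isBond {h} b = ((proj₁ (point true) , in⁺ (proj₂ (point true))) ,
      λ u v u∈ v∈ → path⇒walk (mapPath id in⁺ (connected true u v (in⁻ u∈) (in⁻ v∈)))) ,
    ((proj₁ (point false) , out⁺ (proj₂ (point false))) ,
      λ u v u∈ v∈ → path⇒walk (mapPath id out⁺ (connected false u v (out⁻ u∈) (out⁻ v∈))))
    where
    open Bond b
    in⁺ : ∀ {v} → h v ≡ true → v Subset.∈ Vec.tabulate h
    in⁺ {v} p = lookup⇒∈ (trans (Vecₚ.lookup∘tabulate h v) p)
    in⁻ : ∀ {v} → v Subset.∈ Vec.tabulate h → h v ≡ true
    in⁻ {v} p = trans (sym (Vecₚ.lookup∘tabulate h v)) (∈⇒lookup p)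
    out⁺ : ∀ {v} → h v ≡ false → v Subset.∈ ∁ (Vec.tabulate h)
    out⁺ {v} p = lookup⇒∈∁ (trans (Vecₚ.lookup∘tabulate h v) p)
    out⁻ : ∀ {v} → v Subset.∈ ∁ (Vec.tabulate h) → h v ≡ false
    out⁻ {v} p = trans (sym (Vecₚ.lookup∘tabulate h v)) (∈∁⇒lookup p)

  cut : (Fin n → Bool) → Fin m → ℚ
  cut h e = indicator (h (proj₁ (ends e)) xor h (proj₂ (ends e)))

  cutVec≡cut : ∀ S e → cutVec G S e ≡ cut (lookup S) e
  cutVec≡cut S e with lookup S (proj₁ (ends e)) xor lookup S (proj₂ (ends e))
  ... | true  = refl
  ... | false = refl

  cutVec-tabulate : ∀ h e → cutVec G (Vec.tabulate h) e ≡ cut h e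
  cutVec-tabulate h e = trans (cutVec≡cut (Vec.tabulate h) e)
    (cong₂ (λ a b → indicator (a xor b)) (Vecₚ.lookup∘tabulate h _) (Vecₚ.lookup∘tabulate h _))

  cut-Joins : ∀ h {e u v} → Joins G e u v → cut h e ≡ indicator (h u xor h v)
  cut-Joins h (inj₁ eq) rewrite eq = refl
  cut-Joins h {u = u} {v} (inj₂ eq) rewrite eq = cong indicator (xor-comm (h v) (h u))

  Joins-simple : ∀ {e f u v} → Joins G e u v → Joins G f u v → e ≡ f
  Joins-simple {e} {f} (inj₁ p) (inj₁ q) = simple e f (trans p (sym q))
  Joins-simple {e} {f} (inj₂ p) (inj₂ q) = simple e f (trans p (sym q))
  Joins-simple {e} {f} (inj₁ p) (inj₂ q) = ⊥-elim (ℕₚ.<-asym (ordered p) (ordered q))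
  Joins-simple {e} {f} (inj₂ p) (inj₁ q) = ⊥-elim (ℕₚ.<-asym (ordered p) (ordered q))

  bond-in-polytope : ∀ {h} → Bond h → InBondPolytope G (cut h)
  bond-in-polytope {h} bond = 1 , (λ _ → Vec.tabulate h) , (λ _ → 1ℚ) , (λ _ → bond⇒isBond bond) ,
    (λ _ → ℚₚ.nonNegative⁻¹ 1ℚ) , refl ,
    λ e → sym (trans (+-identityʳ _) (trans (ℚₚ.*-identityˡ _) (cutVec-tabulate h e)))

  module _ (C : Cycle G) where
    open Cycle C

    -- Splitting on the first edge stops the outer sum from unfolding further, so that unification
    -- can name the summand, which is local to cycleVec.
    cycleVec-δ : ∀ e → cycleVec G C e ≡ Σℚ (λ i → δ (edg i) e)
    cycleVec-δ e = trans (proj₂ unfolded) (cong (δ (edg zero) e +_) (Σ-cong agree))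
      where
      unfolded : Σ (Fin k' → ℚ) λ f → cycleVec G C e ≡ δ (edg zero) e + Σℚ f
      unfolded with edg zero Fin.≟ e
      ... | yes _ = _ , refl
      ... | no _  = _ , refl
      agree : ∀ i → proj₁ unfolded i ≡ δ (edg (suc i)) e
      agree i with edg zero Fin.≟ e
      agree i | yes _ with edg (suc i) Fin.≟ e
      ... | yes _ = refl
      ... | no _  = refl
      agree i | no _ with edg (suc i) Fin.≟ e
      ... | yes _ = refl
      ... | no _  = refl

    cycleVec-· : ∀ x → cycleVec G C · x ≡ Σℚ (λ i → x (edg i))
    cycleVec-· x = begin
      Σℚ (λ e → cycleVec G C e * x e)             ≡⟨ ·-comm (cycleVec G C) x ⟩
      Σℚ (λ e → x e * cycleVec G C e)             ≡⟨ Σ-cong (λ e → cong (x e *_) (cycleVec-δ e)) ⟩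
      Σℚ (λ e → x e * Σℚ (λ i → δ (edg i) e))     ≡⟨ Σ-cong (λ e → sym (Σ-*ˡ (x e) (λ i → δ (edg i) e))) ⟩
      Σℚ (λ e → Σℚ (λ i → x e * δ (edg i) e))     ≡⟨ Σ-swap (λ e i → x e * δ (edg i) e) ⟩
      Σℚ (λ i → Σℚ (λ e → x e * δ (edg i) e))     ≡⟨ Σ-cong (λ i → trans (·-comm x (δ (edg i))) (Σ-δ (edg i) x)) ⟩
      Σℚ (λ i → x (edg i))                        ∎
      where open ≡-Reasoning

    cycleVec-cut : ∀ h → cycleVec G C · cut h ≡ Σℚ (λ i → indicator (h (vtx i) xor h (vtx (nextF G i))))
    cycleVec-cut h = trans (cycleVec-· (cut h)) (Σ-cong (λ i → cut-Joins h (edgOk i)))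

    Avoiding : Fin n → Fin n → Set
    Avoiding = Edge (λ e → ¬ InCycle G C e)

    OnCycle : Fin n → Set
    OnCycle v = ∃ λ i → vtx i ≡ v

    onCycle? : Decidable OnCycle
    onCycle? v = Finₚ.any? (λ i → vtx i Fin.≟ v)

    cycle-edge : ∀ {e u v} → InCycle G C e → Joins G e u v → OnCycle u × OnCycle v
    cycle-edge (i , refl) j with Joins-unique (edgOk i) j
    ... | inj₁ (p , q) = (i , p) , (nextF G i , q)
    ... | inj₂ (p , q) = (nextF G i , q) , (i , p)

    cycle-edge-indices : ∀ {e a b} → InCycle G C e → Joins G e (vtx a) (vtx b) → b ≡ nextF G a ⊎ a ≡ nextF G b
    cycle-edge-indices {a = a} {b} (i , refl) j with Joins-unique (edgOk i) j
    ... | inj₁ (p , q) with refl ← vInj _ _ p | refl ← vInj _ _ q = inj₁ refl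
    ... | inj₂ (p , q) with refl ← vInj _ _ p | refl ← vInj _ _ q = inj₂ refl

    -- Excursions off the cycle

    Inside Outside : Fin (suc k') → Fin (suc k') → Fin (suc k') → Set
    Inside  lo hi a = lo Fin.< a × a Fin.< hi
    Outside lo hi b = b Fin.< lo ⊎ hi Fin.< b

    inside-outside : ∀ {lo hi a} → Inside lo hi a → Outside lo hi a → ⊥
    inside-outside (p , q) (inj₁ r) = ℕₚ.<-asym p r
    inside-outside (p , q) (inj₂ r) = ℕₚ.<-asym q r

    -- Both arcs are open, so going around C from one to the other passes over `lo` or `hi`. The
    -- step from the last index to zero is no exception, since an inside index is neither.
    no-cycle-edge-across : ∀ {lo hi a b e} → Inside lo hi a → Outside lo hi b →
                           Joins G e (vtx a) (vtx b) → ¬ InCycle G C e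
    no-cycle-edge-across {lo} {hi} {a} {b} (lo<a , a<hi) out j e∈ with cycle-edge-indices e∈ j
    ... | inj₁ refl with nextF-cases a | out
    ...   | inj₂ (a≡k , _) | _ = ℕₚ.<⇒≱ a<hi (subst (toℕ hi ℕ.≤_) (sym a≡k) (ℕ.s≤s⁻¹ (Finₚ.toℕ<n hi)))
    ...   | inj₁ b≡1+a | inj₁ b<lo = ℕₚ.<-asym lo<a (ℕₚ.<-trans (ℕₚ.≤-reflexive (sym b≡1+a)) b<lo)
    ...   | inj₁ b≡1+a | inj₂ hi<b = ℕₚ.<⇒≱ a<hi (ℕ.s≤s⁻¹ (subst (toℕ hi ℕ.<_) b≡1+a hi<b))
    no-cycle-edge-across {lo} {hi} {a} {b} (lo<a , a<hi) out j e∈ | inj₂ refl with nextF-cases b | out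
    ...   | inj₂ (_ , a≡0) | _ = ℕₚ.n≮0 (subst (toℕ lo ℕ.<_) (cong toℕ a≡0) lo<a)
    ...   | inj₁ a≡1+b | inj₁ b<lo = ℕₚ.<⇒≱ b<lo (ℕ.s≤s⁻¹ (subst (toℕ lo ℕ.<_) a≡1+b lo<a))
    ...   | inj₁ a≡1+b | inj₂ hi<b = ℕₚ.<-asym a<hi (ℕₚ.<-trans hi<b (ℕₚ.≤-reflexive (sym a≡1+b)))

    -- A path that misses both barriers but joins the two open arcs may use edges of C. Its part
    -- from the last inside vertex before the first outside vertex up to that outside vertex does
    -- not.
    module Detour {P : Fin n → Set} {lo hi : Fin (suc k')} (¬lo : ¬ P (vtx lo)) (¬hi : ¬ P (vtx hi)) where

      Result : Set
      Result = ∃ λ a → ∃ λ b → Inside lo hi a × Outside lo hi b × Path Avoiding P (vtx a) (vtx b)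

      position : ∀ i → P (vtx i) → Inside lo hi i ⊎ Outside lo hi i
      position i p with Finₚ.<-cmp i lo | Finₚ.<-cmp i hi
      ... | tri< i<lo _ _ | _             = inj₂ (inj₁ i<lo)
      ... | tri≈ _ refl _ | _             = ⊥-elim (¬lo p)
      ... | tri> _ _ _    | tri> _ _ hi<i = inj₂ (inj₂ hi<i)
      ... | tri> _ _ _    | tri≈ _ refl _ = ⊥-elim (¬hi p)
      ... | tri> _ _ lo<i | tri< i<hi _ _ = inj₁ (lo<i , i<hi)

      -- The prefix runs from the last inside vertex of the cycle to the current vertex, off the cycle in
      -- between.
      detour : ∀ {a v b} → Inside lo hi a → Path Avoiding P (vtx a) v → (v ≡ vtx a ⊎ ¬ OnCycle v) →
               Path _~_ P v (vtx b) → Outside lo hi b → Result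
      detour {b = b} ins prefix (inj₁ eq) [ _ ] out with refl ← vInj _ _ eq = ⊥-elim (inside-outside ins out)
      detour {b = b} ins prefix (inj₂ ¬on) [ _ ] out = ⊥-elim (¬on (b , refl))
      detour {a} ins prefix at (_∷⟨_⟩_ {v = w} p (e , j , _) π) out with onCycle? w
      ... | no ¬on = detour ins (prefix ++ (target prefix ∷⟨ e , j , (λ e∈ → ¬on (proj₂ (cycle-edge e∈ j))) ⟩ [ source π ]))
                       (inj₂ ¬on) π out
      ... | yes (i , refl) with position i (source π)
      ...   | inj₁ ins′ = detour ins′ [ source π ] (inj₁ refl) π out
      ...   | inj₂ out′ = a , i , ins , out′ , prefix ++ (target prefix ∷⟨ e , j , fresh at ⟩ [ source π ])
        where
        -- Either the excursion is a single edge between the two arcs, or its last edge comes from a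
        -- vertex off C.
        fresh : _ → ¬ InCycle G C e
        fresh (inj₁ refl) = no-cycle-edge-across ins out′ j
        fresh (inj₂ ¬on)  = λ e∈ → ¬on (proj₁ (cycle-edge e∈ j))

    module NonInterleaved (non : ¬ Interleaved G C) where

      no-disjoint-crossing : ∀ {P Q : Fin n → Set} → (∀ {v} → P v → Q v → ⊥) →
        ∀ {i₁ i₂ i₃ i₄} → i₁ Fin.< i₂ → i₂ Fin.< i₃ → i₃ Fin.< i₄ →
        Path Avoiding P (vtx i₁) (vtx i₃) → Path Avoiding Q (vtx i₂) (vtx i₄) → ⊥
      no-disjoint-crossing {P} {Q} PQ lt₁ lt₂ lt₃ π ρ =
        non (_ , _ , _ , _ , lt₁ , lt₂ , lt₃ , forget wP , forget wQ ,
             λ a b eq → PQ (Walk.vOk wP a) (subst Q (sym eq) (Walk.vOk wQ b)))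
        where
        wP = path⇒walk π
        wQ = path⇒walk ρ
        forget : ∀ {R u v} → Walk G R (λ e → ¬ InCycle G C e) u v → Walk G (λ _ → Fin 1) (λ e → ¬ InCycle G C e) u v
        forget w = record { len = len ; vert = vert ; start = start ; stop = stop ; vOk = λ _ → zero ; step = step }
          where open Walk w

      no-crossing : ∀ {P Q : Fin n → Set} → (∀ {v} → P v → Q v → ⊥) → ∀ {lo hi a b} →
        Path Avoiding P (vtx lo) (vtx hi) → Path Avoiding Q (vtx a) (vtx b) →
        Inside lo hi a → Outside lo hi b → ⊥
      no-crossing PQ π ρ (lo<a , a<hi) (inj₂ hi<b) = no-disjoint-crossing PQ lo<a a<hi hi<b π ρ
      no-crossing PQ π ρ (lo<a , a<hi) (inj₁ b<lo) =
        no-disjoint-crossing (λ q p → PQ p q) b<lo lo<a a<hi (reverse Edge-sym ρ) π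

      -- A detour from `i₃` to `i₁` on one side of the bond, with barriers `i₂` and `i₄`, yields a
      -- path in G - E(C) whose ends p and q separate `i₂` from `i₄` along C. A second detour, on
      -- the other side and with barriers p and q, crosses the first; the two are disjoint because
      -- they lie on opposite sides.
      no-alternation : ∀ {h} → Bond h → ¬ Alternating (h ∘ vtx)
      no-alternation {h} bond (i₁ , i₂ , i₃ , i₄ , lt₁ , lt₂ , lt₃ , h₂ , h₃ , h₄) =
        finish (D.detour (lt₂ , lt₃) [ h₃ ] (inj₁ refl) (connected β _ _ h₃ refl) (inj₁ lt₁))
        where
        open Bond bond
        β = h (vtx i₁)
        apart : ∀ {v} → h v ≡ β → h v ≡ not β → ⊥
        apart = Boolₚ.not-¬
        module D = Detour {λ v → h v ≡ β} {i₂} {i₄} (λ p → apart p h₂) (λ p → apart p h₄)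
        finish : D.Result → ⊥
        finish (p , q , (i₂<p , p<i₄) , inj₁ q<i₂ , π) =
          let a , b , ins , out , ρ = Detour.detour {lo = q} {p} (apart (target π)) (apart (source π))
                (q<i₂ , i₂<p) [ h₂ ] (inj₁ refl) (connected (not β) _ _ h₂ h₄) (inj₂ p<i₄)
          in no-crossing apart (reverse Edge-sym π) ρ ins out
        finish (p , q , (i₂<p , p<i₄) , inj₂ i₄<q , π) =
          let a , b , ins , out , ρ = Detour.detour {lo = p} {q} (apart (source π)) (apart (target π))
                (p<i₄ , i₄<q) [ h₄ ] (inj₁ refl) (connected (not β) _ _ h₄ h₂) (inj₁ i₂<p)
          in no-crossing apart π ρ ins out

      bond-≤2 : ∀ {h} → Bond h → cycleVec G C · cut h ℚ.≤ twoℚ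
      bond-≤2 {h} bond with cyclic-changes-0-or-2 (h ∘ vtx) (no-alternation bond)
      ... | inj₁ (_ , eq) = subst (ℚ._≤ twoℚ) (sym (trans (cycleVec-cut h) eq)) (ℚₚ.nonNegative⁻¹ twoℚ)
      ... | inj₂ eq       = ℚₚ.≤-reflexive (trans (cycleVec-cut h) eq)

      splitting-bond-≡2 : ∀ {h} → Bond h → ∀ {u v} → OnCycle u → OnCycle v → h u ≢ h v → cycleVec G C · cut h ≡ twoℚ
      splitting-bond-≡2 {h} bond (i , refl) (j , refl) ne with cyclic-changes-0-or-2 (h ∘ vtx) (no-alternation bond)
      ... | inj₁ (const , _) = ⊥-elim (ne (trans (const i) (sym (const j))))
      ... | inj₂ eq          = trans (cycleVec-cut h) eq

Fin⇒suc : ∀ {m} → Fin m → ∃ λ d → m ≡ suc d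
Fin⇒suc {suc d} _ = d , refl

-- Spanning by splitting bonds

∣insert∣ : ∀ {n} (S : Subset n) v → Subset.∣ S [ v ]≔ true ∣ ℕ.≤ suc Subset.∣ S ∣
∣insert∣ (true  ∷ S) zero    = ℕₚ.n≤1+n _
∣insert∣ (false ∷ S) zero    = ℕₚ.≤-refl
∣insert∣ (true  ∷ S) (suc v) = s≤s (∣insert∣ S v)
∣insert∣ (false ∷ S) (suc v) = ∣insert∣ S v

fromList : ∀ {n} → List (Fin n) → Subset n
fromList []      = Subset.⊥
fromList (v ∷ l) = fromList l [ v ]≔ true

∣fromList∣ : ∀ {n} (l : List (Fin n)) → Subset.∣ fromList l ∣ ℕ.≤ length l
∣fromList∣ {n} [] = ℕₚ.≤-reflexive (Subsetₚ.∣⊥∣≡0 n)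
∣fromList∣ (v ∷ l) = ℕₚ.≤-trans (∣insert∣ (fromList l) v) (s≤s (∣fromList∣ l))

∈-fromList⁺ : ∀ {n} {v : Fin n} {l} → v ∈ l → v Subset.∈ fromList l
∈-fromList⁺ {v = v} {w ∷ l} (here refl) = Vecₚ.[]≔-updates (fromList l) v
∈-fromList⁺ {v = v} {w ∷ l} (there v∈) with v Fin.≟ w
... | yes refl = Vecₚ.[]≔-updates (fromList l) v
... | no v≢w   = Vecₚ.[]≔-minimal (fromList l) v w v≢w (∈-fromList⁺ v∈)

∈-fromList⁻ : ∀ {n} {v : Fin n} l → v Subset.∈ fromList l → v ∈ l
∈-fromList⁻ [] v∈ = ⊥-elim (Subsetₚ.∉⊥ v∈)
∈-fromList⁻ {v = v} (w ∷ l) v∈ with v Fin.≟ w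
... | yes refl = here refl
... | no v≢w   = there (∈-fromList⁻ l (Vecₚ.lookup⇒[]= v (fromList l)
                   (trans (sym (Vecₚ.lookup∘update′ v≢w (fromList l) true)) (Vecₚ.[]=⇒lookup v∈))))

does-true : ∀ {P : Set} (d : Dec P) → does d ≡ true → P
does-true (yes p) _ = p

does-false : ∀ {P : Set} (d : Dec P) → does d ≡ false → ¬ P
does-false (no ¬p) _ = ¬p

-- The classes of a linkage are arbitrary predicates; the vertex list of a path has decidable
-- membership, which is needed to colour by legs.
support : ∀ {V : Set} {_~_ : V → V → Set} {P : V → Set} {u v} → Path _~_ P u v →
  ∃ λ l → (∀ {w} → w ∈ l → P w) × u ∈ l × v ∈ l × (∀ {w} → w ∈ l → Path _~_ (_∈ l) u w)
support {u = u} [ p ] = u ∷ [] , (λ { (here refl) → p }) , here refl , here refl , λ { (here refl) → [ here refl ] }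
support {u = u} (p ∷⟨ e ⟩ π) with l , ok , x∈ , v∈ , reach ← support π =
  u ∷ l , (λ { (here refl) → p ; (there w∈) → ok w∈ }) , here refl , there v∈ ,
  λ { (here refl) → [ here refl ] ; (there w∈) → here refl ∷⟨ e ⟩ mapPath id there (reach w∈) }

strengthen : ∀ {V : Set} {_~_ : V → V → Set} {P Q : V → Set} → (∀ {u v} → u ~ v → Q v) →
  ∀ {u v} → Q u → Path _~_ P u v → Path _~_ (λ w → P w × Q w) u v
strengthen f q [ p ]        = [ p , q ]
strengthen f q (p ∷⟨ e ⟩ π) = (p , q) ∷⟨ e ⟩ strengthen f (f e) π

-- In a colouring, nothing marks the vertices of the hub U and those not coloured yet.
Colour : Set
Colour = Maybe (Fin 3)

-- Composed with the final colouring, these are the sides Zᵢ and Zᵢ ∪ U.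
is isOrNothing : Fin 3 → Colour → Bool
is i (just j) = does (i Fin.≟ j)
is i nothing  = false
isOrNothing i (just j) = does (i Fin.≟ j)
isOrNothing i nothing  = true

isNothing : Colour → Bool
isNothing (just _) = false
isNothing nothing  = true

indicatorXor : Bool → Bool → ℚ
indicatorXor a b = indicator (a xor b)

-- The expression of x^{δ(U)} by six splitting bonds, at one edge with end colours `c` and `d` and
-- with the negative terms moved across.
hub-identity : ∀ c d → let term = λ (f : Fin 3 → Colour → Bool) i → indicatorXor (f i c) (f i d) in
  indicatorXor (isNothing c) (isNothing d) + (term is 0F + (term is 1F + term is 2F)) ≡
  term isOrNothing 0F + (term isOrNothing 1F + term isOrNothing 2F)
hub-identity nothing   nothing   = refl
hub-identity nothing   (just 0F) = refl
hub-identity nothing   (just 1F) = refl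
hub-identity nothing   (just 2F) = refl
hub-identity (just 0F) nothing   = refl
hub-identity (just 1F) nothing   = refl
hub-identity (just 2F) nothing   = refl
hub-identity (just 0F) (just 0F) = refl
hub-identity (just 0F) (just 1F) = refl
hub-identity (just 0F) (just 2F) = refl
hub-identity (just 1F) (just 0F) = refl
hub-identity (just 1F) (just 1F) = refl
hub-identity (just 1F) (just 2F) = refl
hub-identity (just 2F) (just 0F) = refl
hub-identity (just 2F) (just 1F) = refl
hub-identity (just 2F) (just 2F) = refl

third : Fin 3 → Fin 3 → Fin 3
third 0F 1F = 2F
third 0F _  = 1F
third 1F 0F = 2F
third 1F _  = 0F
third 2F 0F = 1F
third 2F _  = 0F

hueChange : Fin 3 → Fin 3 → Fin 3 → ℚ
hueChange i s t = indicatorXor (is i (just s)) (is i (just t))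

-- A change that is not between `j` and `k` has the third hue at one end and `j` or `k` at the
-- other, so it counts once on either side.
third-identity : ∀ j k → j ≢ k → ∀ s t → ¬ (s ≡ j × t ≡ k) → ¬ (s ≡ k × t ≡ j) →
  hueChange (third j k) s t ≡ hueChange j s t + hueChange k s t
third-identity = from-yes (Finₚ.all? λ j → Finₚ.all? λ k → ¬? (j Fin.≟ k) →-dec Finₚ.all? λ s → Finₚ.all? λ t →
  ¬? ((s Fin.≟ j) ×-dec (t Fin.≟ k)) →-dec (¬? ((s Fin.≟ k) ×-dec (t Fin.≟ j)) →-dec
  (hueChange (third j k) s t ℚₚ.≟ hueChange j s t + hueChange k s t)))

other : Fin 3 → Fin 3
other 0F = 1F
other _  = 0F

other≢ : ∀ i → other i ≢ i
other≢ 0F ()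
other≢ 1F ()
other≢ 2F ()

module _ (G : Graph) (three : ThreeConnected G) where
  open Graph G
  private
    V = Fin n
    _~ᴳ_ = _~_ G
  open import Data.List.Membership.DecPropositional (Fin._≟_ {n}) using (_∈?_)

  connected-∉ : ∀ M → length M ℕ.≤ 2 → Connected G (_∉ M)
  connected-∉ M ≤2 u v u∉ v∉ = mapPath id (λ w∈∁ w∈ → Subsetₚ.x∈∁p⇒x∉p w∈∁ (∈-fromList⁺ w∈))
    (walk⇒path G (proj₂ (proj₂ three (fromList M) (ℕₚ.≤-trans (∣fromList∣ M) ≤2)) u v (in∁ u∉) (in∁ v∉)))
    where
    in∁ : ∀ {w} → w ∉ M → w Subset.∈ ∁ (fromList M)
    in∁ w∉ = Subsetₚ.x∉p⇒x∈∁p (w∉ ∘ ∈-fromList⁻ M)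

  point-∉ : ∀ M → length M ℕ.≤ 2 → ∃ (_∉ M)
  point-∉ M ≤2 with (v , v∈∁) , _ ← proj₂ three (fromList M) (ℕₚ.≤-trans (∣fromList∣ M) ≤2) =
    v , λ v∈ → Subsetₚ.x∈∁p⇒x∉p v∈∁ (∈-fromList⁺ v∈)

  member : List V → V → Bool
  member M v = does (v ∈? M)

  small-bond : ∀ M → length M ℕ.≤ 2 → ∃ (_∈ M) → Connected G (_∈ M) → Bond G (member M)
  small-bond M ≤2 (u , u∈) conn = record
    { point = λ { true → u , dec-true (u ∈? M) u∈ ; false → let w , w∉ = point-∉ M ≤2 in w , dec-false (w ∈? M) w∉ }
    ; connected = λ
      { true  x y p q → mapPath id (λ {w} → dec-true (w ∈? M)) (conn x y (does-true (x ∈? M) p) (does-true (y ∈? M) q))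
      ; false x y p q → mapPath id (λ {w} → dec-false (w ∈? M))
          (connected-∉ M ≤2 x y (does-false (x ∈? M) p) (does-false (y ∈? M) q)) } }

  singleton-connected : ∀ u → Connected G (_∈ u ∷ [])
  singleton-connected u _ _ (here refl) (here refl) = [ here refl ]

  pair-connected : ∀ {u v} → u ~ᴳ v → Connected G (_∈ u ∷ v ∷ [])
  pair-connected e _ _ (here refl) (here refl) = [ here refl ]
  pair-connected e _ _ (here refl) (there (here refl)) = here refl ∷⟨ e ⟩ [ there (here refl) ]
  pair-connected e _ _ (there (here refl)) (here refl) = there (here refl) ∷⟨ Edge-sym G e ⟩ [ here refl ]
  pair-connected e _ _ (there (here refl)) (there (here refl)) = [ there (here refl) ]

  hub-connected : ∀ {P hub} → (∀ v → P v → Path _~ᴳ_ P v hub) → Connected G P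
  hub-connected toHub u v p q = toHub u p ++ reverse (Edge-sym G) (toHub v q)

  adjacent? : ∀ u v → Dec (u ~ᴳ v)
  adjacent? u v = map′ (λ (e , j) → e , j , zero) (λ (e , j , _) → e , j)
    (Finₚ.any? λ e → ≡-dec Fin._≟_ Fin._≟_ (ends e) (u , v) ⊎-dec ≡-dec Fin._≟_ Fin._≟_ (ends e) (v , u))

  -- An edge meeting {u, v} in one vertex is counted once on both sides; only uv itself is counted
  -- twice on the left and not by the cut of the pair.
  edge-identity : ∀ {e u v} → Joins G e u v → ∀ f →
    cut G (member (u ∷ [])) f + cut G (member (v ∷ [])) f ≡
    cut G (member (u ∷ v ∷ [])) f + (δ e f + δ e f)
  edge-identity {e} {u} {v} j f = go (p Fin.≟ u) (p Fin.≟ v) (q Fin.≟ u) (q Fin.≟ v)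
    where
    p = proj₁ (ends f)
    q = proj₂ (ends f)
    u≢v = Joins⇒≢ G j
    p≢q : p ≢ q
    p≢q = Joins⇒≢ G {f} (inj₁ refl)
    same : ∀ {x} → Joins G f u v → x ≡ twoℚ → x ≡ δ e f + δ e f
    same jf eq = trans eq (sym (cong₂ _+_ d d)) where d = δ-same {i = e} {f} (Joins-simple G j jf)
    other-edge : ¬ Joins G f u v → ∀ x → x ≡ x + (δ e f + δ e f)
    other-edge ¬j x = trans (sym (+-identityʳ x)) (cong (x +_) (sym (cong₂ _+_ d d)))
      where d = δ-different {i = e} {f} (λ { refl → ¬j j })
    go : (pu : Dec (p ≡ u)) (pv : Dec (p ≡ v)) (qu : Dec (q ≡ u)) (qv : Dec (q ≡ v)) →
      indicatorXor (does pu ∨ false) (does qu ∨ false) + indicatorXor (does pv ∨ false) (does qv ∨ false) ≡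
      indicatorXor (does pu ∨ (does pv ∨ false)) (does qu ∨ (does qv ∨ false)) + (δ e f + δ e f)
    go (yes pu) (yes pv) _ _ = ⊥-elim (u≢v (trans (sym pu) pv))
    go _ _ (yes qu) (yes qv) = ⊥-elim (u≢v (trans (sym qu) qv))
    go (yes pu) _ (yes qu) _ = ⊥-elim (p≢q (trans pu (sym qu)))
    go _ (yes pv) _ (yes qv) = ⊥-elim (p≢q (trans pv (sym qv)))
    go (yes pu) (no _) (no _) (yes qv) = trans (same (inj₁ (cong₂ _,_ pu qv)) refl) (sym (+-identityˡ _))
    go (no _) (yes pv) (yes qu) (no _) = trans (same (inj₂ (cong₂ _,_ pv qu)) refl) (sym (+-identityˡ _))
    go (yes pu) (no ¬pv) (no _) (no ¬qv) =
      other-edge (λ { (inj₁ eq) → ¬qv (cong proj₂ eq) ; (inj₂ eq) → ¬pv (cong proj₁ eq) }) 1ℚ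
    go (no ¬pu) (yes pv) (no ¬qu) (no ¬qv) =
      other-edge (λ { (inj₁ eq) → ¬pu (cong proj₁ eq) ; (inj₂ eq) → ¬qu (cong proj₂ eq) }) 1ℚ
    go (no ¬pu) (no ¬pv) (yes _) (no ¬qv) =
      other-edge (λ { (inj₁ eq) → ¬pu (cong proj₁ eq) ; (inj₂ eq) → ¬pv (cong proj₁ eq) }) 1ℚ
    go (no ¬pu) (no ¬pv) (no ¬qu) (yes _) =
      other-edge (λ { (inj₁ eq) → ¬pu (cong proj₁ eq) ; (inj₂ eq) → ¬pv (cong proj₁ eq) }) 1ℚ
    go (no ¬pu) (no ¬pv) (no ¬qu) (no ¬qv) =
      other-edge (λ { (inj₁ eq) → ¬pu (cong proj₁ eq) ; (inj₂ eq) → ¬pv (cong proj₁ eq) }) 0ℚ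

  module _ (C : Cycle G) (non : ¬ Interleaved G C) where
    open Cycle C
    open NonInterleaved G C non

    private
      a = cycleVec G C
      On = OnCycle G C

    cycle-escapes : ∀ M → length M ℕ.≤ 2 → ∃ λ i → vtx i ∉ M
    cycle-escapes M ≤2 with Finₚ.any? (λ i → ¬? (vtx i ∈? M))
    ... | yes found = found
    ... | no none = ⊥-elim (ℕₚ.<⇒≱ (s≤s long) (ℕₚ.≤-trans (Finₚ.injective⇒≤ inj) ≤2))
      where
      all∈ : ∀ i → vtx i ∈ M
      all∈ i = decidable-stable (vtx i ∈? M) (λ i∉ → none (i , i∉))
      inj : ∀ {i j} → index (all∈ i) ≡ index (all∈ j) → i ≡ j
      inj {i} {j} eq = vInj i j (index-injective (all∈ i) (all∈ j) eq)

    Detected : (Fin m → ℚ) → Set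
    Detected b = ∃ λ h → Bond G h × a · cut G h ≡ twoℚ × b · cut G h ≢ 0ℚ

    -- The dichotomy behind all spanning arguments: either this bond already detects `b`, or its cut
    -- is orthogonal to `b`, and orthogonality passes along linear identities between cuts.
    detect : ∀ b {h} → Bond G h → ∀ {u v} → On u → On v → h u ≡ true → h v ≡ false → Detected b ⊎ (b · cut G h ≡ 0ℚ)
    detect b {h} bond u∈ v∈ hu hv with (b · cut G h) ℚₚ.≟ 0ℚ
    ... | yes ≡0 = inj₂ ≡0
    ... | no ≢0  = inj₁ (h , bond , splitting-bond-≡2 bond u∈ v∈ (λ eq → true≢false (trans (sym hu) (trans eq hv))) , ≢0)
      where true≢false : true ≢ false
            true≢false ()

    module OffCycle (M : List V) (≤2 : length M ℕ.≤ 2) (u₀ : V) (u₀∈ : u₀ ∈ M) (M-connected : Connected G (_∈ M))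
                    (off : ∀ {v} → v ∈ M → ¬ On v) where

      Neighbour : V → Set
      Neighbour v = v ∉ M × Any (λ u → u ~ᴳ v) M

      neighbour? : Decidable Neighbour
      neighbour? v = ¬? (v ∈? M) ×-dec Any.any? (λ u → adjacent? u v) M

      outside? : (e : V × V) → Dec (proj₁ e ∉ M × proj₂ e ∉ M)
      outside? (u , v) = ¬? (u ∈? M) ×-dec ¬? (v ∈? M)

      -- Menger's theorem is applied to G - M, so that the legs leave the hub `M` for good.
      E : List (V × V)
      E = filter outside? (List.map ends (allFin m))

      listed : ∀ {e u v} → ends e ≡ (u , v) → (u , v) ∈ List.map ends (allFin m)
      listed {e} eq = subst (_∈ List.map ends (allFin m)) eq (∈-map⁺ ends (∈-allFin e))

      E⁺ : ∀ {u v} → u ~ᴳ v → u ∉ M → v ∉ M → AdjacentIn E u v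
      E⁺ (e , inj₁ eq , _) u∉ v∉ = inj₁ (∈-filter⁺ outside? (listed eq) (u∉ , v∉))
      E⁺ (e , inj₂ eq , _) u∉ v∉ = inj₂ (∈-filter⁺ outside? (listed eq) (v∉ , u∉))

      E⁻ : ∀ {u v} → AdjacentIn E u v → u ~ᴳ v × v ∉ M
      E⁻ (inj₁ e∈) with e∈′ , (_ , v∉) ← ∈-filter⁻ outside? {xs = List.map ends (allFin m)} e∈
        with e , _ , eq ← ∈-map⁻ ends e∈′ = (e , inj₁ (sym eq) , zero) , v∉
      E⁻ (inj₂ e∈) with e∈′ , (v∉ , _) ← ∈-filter⁻ outside? {xs = List.map ends (allFin m)} e∈
        with e , _ , eq ← ∈-map⁻ ends e∈′ = (e , inj₂ (sym eq) , zero) , v∉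

      -- Deleting the at most two separating vertices outside `M` leaves G connected, with `M` and
      -- some vertex of C in it. A path between these must leave M ∪ left by an edge into the right
      -- side. Starting in `M`, that edge ends at a neighbour of `M`, which is never right; starting
      -- outside, it would be an edge of G - M from left to right.
      no-separation : ¬ Separation (AdjacentIn E) Neighbour On 3
      no-separation sep = contradict (crossing left? (connected-∉ X X≤2 u₀ c u₀∉X c∉X) (inj₁ u₀∈) c-not-left)
        where
        open Separation sep
        notM? : Decidable (_∉ M)
        notM? v = ¬? (v ∈? M)
        -- Labels on `M` carry no information here, and the hub has to survive the deletion, so its
        -- vertices are removed from the separator.
        X = filter notM? cover
        X≤2 : length X ℕ.≤ 2
        X≤2 = ℕₚ.≤-trans (Listₚ.length-filter notM? cover) (ℕ.s≤s⁻¹ small)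
        Left : V → Set
        Left v = v ∈ M ⊎ side v ≡ left
        left? : Decidable Left
        left? v = (v ∈? M) ⊎-dec (side v ≟ˢ left)
        c = vtx (proj₁ (cycle-escapes X X≤2))
        c∉X = proj₂ (cycle-escapes X X≤2)
        u₀∉X : u₀ ∉ X
        u₀∉X u∈ = proj₂ (∈-filter⁻ notM? {xs = cover} u∈) u₀∈
        c-not-left : ¬ Left c
        c-not-left (inj₁ c∈) = off c∈ (_ , refl)
        c-not-left (inj₂ l)  = B-side (_ , refl) l
        is-right : ∀ {y} → y ∉ X → ¬ Left y → side y ≡ right
        is-right {y} y∉X ¬left with side y in eq
        ... | left   = ⊥-elim (¬left (inj₂ refl))
        ... | middle = ⊥-elim (y∉X (∈-filter⁺ notM? (covers eq) (¬left ∘ inj₁)))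
        ... | right  = refl
        contradict : (∃ λ x → ∃ λ y → x ∉ X × y ∉ X × Left x × ¬ Left y × x ~ᴳ y) → ⊥
        contradict (x , y , _ , y∉X , x-left , ¬y-left , e) with x ∈? M | x-left
        ... | yes x∈ | _       = A-side (¬y-left ∘ inj₁ , Any.map (λ { refl → e }) x∈) (is-right y∉X ¬y-left)
        ... | no x∉  | inj₁ x∈ = x∉ x∈
        ... | no x∉  | inj₂ l  = separates (E⁺ e x∉ (¬y-left ∘ inj₁)) l (is-right y∉X ¬y-left)

      record Legs : Set where
        field
          leg       : Fin 3 → List V
          leg-∉     : ∀ {i v} → v ∈ leg i → v ∉ M
          disjoint  : ∀ {i j v} → v ∈ leg i → v ∈ leg j → i ≡ j
          root tip  : Fin 3 → V
          root-near : ∀ i → ∃ λ u → u ∈ M × u ~ᴳ root i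
          tip-on    : ∀ i → On (tip i)
          root∈     : ∀ i → root i ∈ leg i
          tip∈      : ∀ i → tip i ∈ leg i
          reach     : ∀ {i v} → v ∈ leg i → Path _~ᴳ_ (_∈ leg i) (root i) v

      legs : Legs
      legs with menger 3 E neighbour? (onCycle? G C)
      ... | inj₁ sep  = ⊥-elim (no-separation sep)
      ... | inj₂ link = record
        { leg = λ i → proj₁ (supp i)
        ; leg-∉ = λ {i} v∈ → proj₂ (proj₁ (proj₂ (supp i)) v∈)
        ; disjoint = λ {i} {j} v∈ v∈′ → L.disjoint (proj₁ (proj₁ (proj₂ (supp i)) v∈)) (proj₁ (proj₁ (proj₂ (supp j)) v∈′))
        ; root = L.from ; tip = L.to
        ; root-near = λ i → find (proj₂ (L.from∈ i))
        ; tip-on = L.to∈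
        ; root∈ = λ i → proj₁ (proj₂ (proj₂ (supp i)))
        ; tip∈ = λ i → proj₁ (proj₂ (proj₂ (proj₂ (supp i))))
        ; reach = λ {i} → proj₂ (proj₂ (proj₂ (proj₂ (supp i)))) }
        where
        module L = Linkage link
        supp = λ i → support (mapPath (proj₁ ∘ E⁻) id (strengthen (proj₂ ∘ E⁻) (proj₁ (L.from∈ i)) (L.path i)))

      open Legs legs

      Good : (V → Colour) → Set
      Good κ = (∀ {v i} → κ v ≡ just i → v ∉ M) × (∀ {v i} → κ v ≡ just i → Path _~ᴳ_ (λ w → κ w ≡ just i) (root i) v)

      _⊑_ : (κ κ′ : V → Colour) → Set
      κ ⊑ κ′ = ∀ {v i} → κ v ≡ just i → κ′ v ≡ just i

      Coloured : (V → Colour) → V → Set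
      Coloured κ v = ∃ λ i → κ v ≡ just i

      κ₀ : V → Colour
      κ₀ v with Finₚ.any? (λ i → v ∈? leg i)
      ... | yes (i , _) = just i
      ... | no _        = nothing

      κ₀⁺ : ∀ {v i} → v ∈ leg i → κ₀ v ≡ just i
      κ₀⁺ {v} {i} v∈ with Finₚ.any? (λ i → v ∈? leg i)
      ... | yes (j , v∈′) = cong just (disjoint v∈′ v∈)
      ... | no none       = ⊥-elim (none (i , v∈))

      κ₀⁻ : ∀ {v i} → κ₀ v ≡ just i → v ∈ leg i
      κ₀⁻ {v} eq with Finₚ.any? (λ i → v ∈? leg i)
      κ₀⁻ {v} refl | yes (i , v∈) = v∈

      κ₀-good : Good κ₀
      κ₀-good = (λ {v} eq → leg-∉ (κ₀⁻ {v} eq)) , λ {v} eq → mapPath id κ₀⁺ (reach (κ₀⁻ {v} eq))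

      paint : ∀ {κ v w i} → Good κ → v ∉ M → v ~ᴳ w → κ v ≡ nothing → κ w ≡ just i →
              ∃ λ κ′ → Good κ′ × κ ⊑ κ′ × Coloured κ′ v
      paint {κ} {v} {w} {i} (κ-∉ , κ-reach) v∉ e κv κw = κ′ , (κ′-∉ , κ′-reach) , ext , i , κ′v
        where
        κ′ : V → Colour
        κ′ x with x Fin.≟ v
        ... | yes _ = just i
        ... | no _  = κ x
        κ′v : κ′ v ≡ just i
        κ′v with v Fin.≟ v
        ... | yes _  = refl
        ... | no v≢v = ⊥-elim (v≢v refl)
        ext : κ ⊑ κ′
        ext {x} eq with x Fin.≟ v
        ... | yes refl with () ← trans (sym κv) eq
        ... | no _ = eq
        κ′⁻ : ∀ x {j} → κ′ x ≡ just j → (x ≡ v × j ≡ i) ⊎ κ x ≡ just j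
        κ′⁻ x eq with x Fin.≟ v
        κ′⁻ x refl | yes x≡v = inj₁ (x≡v , refl)
        κ′⁻ x eq   | no _    = inj₂ eq
        κ′-∉ : ∀ {x j} → κ′ x ≡ just j → x ∉ M
        κ′-∉ {x} eq with κ′⁻ x eq
        ... | inj₁ (refl , _) = v∉
        ... | inj₂ eq′        = κ-∉ eq′
        κ′-reach : ∀ {x j} → κ′ x ≡ just j → Path _~ᴳ_ (λ y → κ′ y ≡ just j) (root j) x
        κ′-reach {x} eq with κ′⁻ x eq
        ... | inj₁ (refl , refl) = mapPath id ext (κ-reach κw) ++ (ext κw ∷⟨ Edge-sym G e ⟩ [ κ′v ])
        ... | inj₂ eq′           = mapPath id ext (κ-reach eq′)

      -- The path is coloured backwards from its coloured end: an uncoloured vertex takes the colour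
      -- of its successor, through which it reaches the root of that class.
      absorb : ∀ {κ v r} → Path _~ᴳ_ (_∉ M) v r → Coloured κ r → Good κ → ∃ λ κ′ → Good κ′ × κ ⊑ κ′ × Coloured κ′ v
      absorb [ _ ] c good = _ , good , id , c
      absorb {v = v} (v∉ ∷⟨ e ⟩ π) c good with κ₁ , good₁ , ext₁ , (i , κ₁w) ← absorb π c good with κ₁ v in eq
      ... | just j  = κ₁ , good₁ , ext₁ , j , eq
      ... | nothing with κ₂ , good₂ , ext₂ , c₂ ← paint good₁ v∉ e eq κ₁w = κ₂ , good₂ , ext₂ ∘ ext₁ , c₂

      -- G - M is connected, since `M` has at most two vertices, so every vertex outside `M` has a
      -- path to an already coloured root.
      absorbAll : ∀ (xs : List V) → ∃ λ κ → Good κ × κ₀ ⊑ κ × (∀ {v} → v ∈ xs → v ∉ M → Coloured κ v)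
      absorbAll [] = κ₀ , κ₀-good , id , λ ()
      absorbAll (x ∷ xs) with κ , good , ext , done ← absorbAll xs with x ∈? M
      ... | yes x∈ = κ , good , ext , λ { (here refl) x∉ → ⊥-elim (x∉ x∈) ; (there v∈) v∉ → done v∈ v∉ }
      ... | no x∉
        with κ′ , good′ , ext′ , c ← absorb (connected-∉ M ≤2 x (root 0F) x∉ (leg-∉ (root∈ 0F)))
                                            (0F , ext (κ₀⁺ (root∈ 0F))) good =
        κ′ , good′ , ext′ ∘ ext , λ { (here refl) _ → c ; (there v∈) v∉ → let i , eq = done v∈ v∉ in i , ext′ eq }

      colouring = absorbAll (allFin n)
      κ = proj₁ colouring
      κ-∉ : ∀ {v i} → κ v ≡ just i → v ∉ M
      κ-∉ = proj₁ (proj₁ (proj₂ colouring))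
      κ-reach : ∀ {v i} → κ v ≡ just i → Path _~ᴳ_ (λ w → κ w ≡ just i) (root i) v
      κ-reach = proj₂ (proj₁ (proj₂ colouring))
      κ-root : ∀ i → κ (root i) ≡ just i
      κ-root i = proj₁ (proj₂ (proj₂ colouring)) (κ₀⁺ (root∈ i))
      κ-tip : ∀ i → κ (tip i) ≡ just i
      κ-tip i = proj₁ (proj₂ (proj₂ colouring)) (κ₀⁺ (tip∈ i))
      κ-total : ∀ {v} → v ∉ M → Coloured κ v
      κ-total = proj₂ (proj₂ (proj₂ colouring)) (∈-allFin _)

      κ-∈ : ∀ {v} → v ∈ M → κ v ≡ nothing
      κ-∈ {v} v∈ with κ v in eq
      ... | just i  = ⊥-elim (κ-∉ eq v∈)
      ... | nothing = refl

      κ-nothing : ∀ {v} → κ v ≡ nothing → v ∈ M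
      κ-nothing {v} eq = decidable-stable (v ∈? M) λ v∉ → case (trans (sym eq) (proj₂ (κ-total v∉)))
        where case : ∀ {i : Fin 3} → nothing ≢ just i
              case ()

      -- Any union of classes together with the hub is connected: each class is connected to its
      -- root, and each root has a neighbour in `M`. This covers the complement of Zᵢ as well as Zᵢ
      -- ∪ U.
      connected-with-M : ∀ (f : Colour → Bool) β → f nothing ≡ β → Connected G (λ v → f (κ v) ≡ β)
      connected-with-M f β f-nothing = hub-connected toHub
        where
        P : V → Set
        P v = f (κ v) ≡ β
        in-M : ∀ {v} → v ∈ M → P v
        in-M v∈ = trans (cong f (κ-∈ v∈)) f-nothing
        within-M : ∀ {v} → v ∈ M → Path _~ᴳ_ P v u₀
        within-M v∈ = mapPath id in-M (M-connected _ u₀ v∈ u₀∈)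
        toHub : ∀ v → P v → Path _~ᴳ_ P v u₀
        toHub v p with κ v in eq
        ... | nothing = within-M (κ-nothing eq)
        ... | just i with u , u∈ , e ← root-near i =
          reverse (Edge-sym G) (mapPath id same (κ-reach eq)) ++ (same (κ-root i) ∷⟨ Edge-sym G e ⟩ within-M u∈)
          where
          same : ∀ {w} → κ w ≡ just i → P w
          same eq′ = trans (cong f eq′) p

      is-self : ∀ i → is i (just i) ≡ true
      is-self i = dec-true (i Fin.≟ i) refl
      is-other : ∀ {i j} → i ≢ j → is i (just j) ≡ false
      is-other {i} {j} ne = dec-false (i Fin.≟ j) ne

      is⁻ : ∀ {i c} → is i c ≡ true → c ≡ just i
      is⁻ {i} {just j} eq = cong just (sym (does-true (i Fin.≟ j) eq))

      class-bond : ∀ i → Bond G (is i ∘ κ)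
      class-bond i = record
        { point = λ { true → root i , trans (cong (is i) (κ-root i)) (is-self i)
                    ; false → u₀ , cong (is i) (κ-∈ u₀∈) }
        ; connected = λ { true → hub-connected (λ v p → reverse (Edge-sym G)
                            (mapPath id (λ eq → trans (cong (is i) eq) (is-self i)) (κ-reach (is⁻ p))))
                        ; false → connected-with-M (is i) false refl } }

      hue : Fin (suc k') → Fin 3
      hue t = proj₁ (κ-total {vtx t} (λ t∈ → off t∈ (t , refl)))
      κ-vtx : ∀ t → κ (vtx t) ≡ just (hue t)
      κ-vtx t = proj₂ (κ-total {vtx t} (λ t∈ → off t∈ (t , refl)))

      hue-changes : ∀ i → Σℚ (λ t → hueChange i (hue t) (hue (nextF G t))) ≡ twoℚ
      hue-changes i = begin
        Σℚ (λ t → hueChange i (hue t) (hue (nextF G t)))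
          ≡⟨ Σ-cong (λ t → cong₂ (λ c d → indicatorXor (is i c) (is i d)) (sym (κ-vtx t)) (sym (κ-vtx (nextF G t)))) ⟩
        Σℚ (λ t → indicatorXor (is i (κ (vtx t))) (is i (κ (vtx (nextF G t)))))
          ≡⟨ sym (cycleVec-cut G C (is i ∘ κ)) ⟩
        a · cut G (is i ∘ κ)
          ≡⟨ splitting-bond-≡2 (class-bond i) (tip-on i) (tip-on (other i)) differ ⟩
        twoℚ ∎
        where
        open ≡-Reasoning
        differ : is i (κ (tip i)) ≢ is i (κ (tip (other i)))
        differ eq rewrite κ-tip i | κ-tip (other i) | is-self i | is-other {i} {other i} (λ p → other≢ i (sym p)) with () ← eq

      -- If no cycle edge joined classes j and k, every change of hue j or k along C would be a change of
      -- the third hue, so 2 = 2 + 2.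
      classes-adjacent : ∀ j k → j ≢ k → ∃ λ x → ∃ λ y → κ x ≡ just j × κ y ≡ just k × x ~ᴳ y
      classes-adjacent j k j≢k
        with Finₚ.any? (λ t → ((hue t Fin.≟ j) ×-dec (hue (nextF G t) Fin.≟ k)) ⊎-dec
                              ((hue t Fin.≟ k) ×-dec (hue (nextF G t) Fin.≟ j)))
      ... | yes (t , inj₁ (p , q)) =
        vtx t , vtx (nextF G t) , trans (κ-vtx t) (cong just p) , trans (κ-vtx (nextF G t)) (cong just q) ,
        edg t , edgOk t , zero
      ... | yes (t , inj₂ (p , q)) =
        vtx (nextF G t) , vtx t , trans (κ-vtx (nextF G t)) (cong just q) , trans (κ-vtx t) (cong just p) ,
        edg t , Joins-sym G (edgOk t) , zero
      ... | no none = ⊥-elim (2≢4 (begin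
        twoℚ                                 ≡⟨ sym (hue-changes (third j k)) ⟩
        Σℚ (change (third j k))              ≡⟨ Σ-cong (λ t → third-identity j k j≢k (hue t) (hue (nextF G t))
                                                  (λ p → none (t , inj₁ p)) (λ p → none (t , inj₂ p))) ⟩
        Σℚ (λ t → change j t + change k t)   ≡⟨ Σ-+ (change j) (change k) ⟩
        Σℚ (change j) + Σℚ (change k)        ≡⟨ cong₂ _+_ (hue-changes j) (hue-changes k) ⟩
        twoℚ + twoℚ                          ∎))
        where
        open ≡-Reasoning
        change : Fin 3 → Fin (suc k') → ℚ
        change i t = hueChange i (hue t) (hue (nextF G t))
        2≢4 : twoℚ ≢ twoℚ + twoℚ
        2≢4 ()

      -- The complement contains no hub vertex to connect it; it consists of the two other classes,
      -- joined by an edge of C.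
      class-or-M-bond : ∀ i → Bond G (isOrNothing i ∘ κ)
      class-or-M-bond i = record
        { point = λ { true → u₀ , cong (isOrNothing i) (κ-∈ u₀∈)
                    ; false → root (other i) , in-class (λ p → other≢ i (sym p)) (κ-root (other i)) }
        ; connected = λ { true → connected-with-M (isOrNothing i) true refl
                        ; false → hub-connected toHub } }
        where
        P : V → Set
        P v = isOrNothing i (κ v) ≡ false
        in-class : ∀ {j v} → i ≢ j → κ v ≡ just j → P v
        in-class {j} ne eq = trans (cong (isOrNothing i) eq) (dec-false (i Fin.≟ j) ne)
        out⁻ : ∀ {c} → isOrNothing i c ≡ false → ∃ λ j → i ≢ j × c ≡ just j
        out⁻ {just j} eq = j , does-false (i Fin.≟ j) eq , refl
        toHub : ∀ v → P v → Path _~ᴳ_ P v (root (other i))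
        toHub v p with j , i≢j , eq ← out⁻ p with j Fin.≟ other i
        ... | yes refl = reverse (Edge-sym G) (mapPath id (in-class i≢j) (κ-reach eq))
        ... | no j≢o with x , y , κx , κy , e ← classes-adjacent j (other i) j≢o =
          reverse (Edge-sym G) (mapPath id (in-class i≢j) (κ-reach eq)) ++
          (mapPath id (in-class i≢j) (κ-reach κx) ++
          (in-class i≢j κx ∷⟨ e ⟩ reverse (Edge-sym G) (mapPath id (in-class (λ p → other≢ i (sym p))) (κ-reach κy))))

      member≡ : ∀ v → member M v ≡ isNothing (κ v)
      member≡ v with v ∈? M
      ... | yes v∈ rewrite κ-∈ v∈ = refl
      ... | no v∉ rewrite proj₂ (κ-total v∉) = refl

      cut-hub : ∀ e → cut G (member M) e + (cut G (is 0F ∘ κ) e + (cut G (is 1F ∘ κ) e + cut G (is 2F ∘ κ) e)) ≡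
                cut G (isOrNothing 0F ∘ κ) e + (cut G (isOrNothing 1F ∘ κ) e + cut G (isOrNothing 2F ∘ κ) e)
      cut-hub e = trans (cong (_+ (cut G (is 0F ∘ κ) e + (cut G (is 1F ∘ κ) e + cut G (is 2F ∘ κ) e)))
                     (cong₂ indicatorXor (member≡ (proj₁ (ends e))) (member≡ (proj₂ (ends e)))))
                   (hub-identity (κ (proj₁ (ends e))) (κ (proj₂ (ends e))))

      detect-class : ∀ b i → Detected b ⊎ (b · cut G (is i ∘ κ) ≡ 0ℚ)
      detect-class b i = detect b (class-bond i) (tip-on i) (tip-on (other i))
        (trans (cong (is i) (κ-tip i)) (is-self i))
        (trans (cong (is i) (κ-tip (other i))) (is-other (λ p → other≢ i (sym p))))

      detect-class-or-M : ∀ b i → Detected b ⊎ (b · cut G (isOrNothing i ∘ κ) ≡ 0ℚ)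
      detect-class-or-M b i = detect b (class-or-M-bond i) (tip-on i) (tip-on (other i))
        (trans (cong (isOrNothing i) (κ-tip i)) (is-self i))
        (trans (cong (isOrNothing i) (κ-tip (other i))) (is-other (λ p → other≢ i (sym p))))

      three-zeros : ∀ b (x y z : Fin m → ℚ) → b · x ≡ 0ℚ → b · y ≡ 0ℚ → b · z ≡ 0ℚ → b · (λ e → x e + (y e + z e)) ≡ 0ℚ
      three-zeros b x y z p q r = trans (·-+ b x (λ e → y e + z e)) (cong₂ _+_ p (trans (·-+ b y z) (cong₂ _+_ q r)))

      detect-M : ∀ b → Detected b ⊎ (b · cut G (member M) ≡ 0ℚ)
      detect-M b with detect-class b 0F | detect-class b 1F | detect-class b 2F
                    | detect-class-or-M b 0F | detect-class-or-M b 1F | detect-class-or-M b 2F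
      ... | inj₁ d | _ | _ | _ | _ | _ = inj₁ d
      ... | inj₂ _ | inj₁ d | _ | _ | _ | _ = inj₁ d
      ... | inj₂ _ | inj₂ _ | inj₁ d | _ | _ | _ = inj₁ d
      ... | inj₂ _ | inj₂ _ | inj₂ _ | inj₁ d | _ | _ = inj₁ d
      ... | inj₂ _ | inj₂ _ | inj₂ _ | inj₂ _ | inj₁ d | _ = inj₁ d
      ... | inj₂ _ | inj₂ _ | inj₂ _ | inj₂ _ | inj₂ _ | inj₁ d = inj₁ d
      ... | inj₂ x | inj₂ y | inj₂ z | inj₂ x′ | inj₂ y′ | inj₂ z′ = inj₂ (begin
        b · cut G (member M)                               ≡⟨ sym (+-identityʳ _) ⟩
        b · cut G (member M) + 0ℚ
          ≡⟨ cong (b · cut G (member M) +_) (sym (three-zeros b _ _ _ x y z)) ⟩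
        b · cut G (member M) + b · _                       ≡⟨ sym (·-+ b (cut G (member M)) _) ⟩
        b · (λ e → cut G (member M) e + (cut G (is 0F ∘ κ) e + (cut G (is 1F ∘ κ) e + cut G (is 2F ∘ κ) e)))
                                                           ≡⟨ Σ-cong (λ e → cong (b e *_) (cut-hub e)) ⟩
        b · (λ e → cut G (isOrNothing 0F ∘ κ) e + (cut G (isOrNothing 1F ∘ κ) e + cut G (isOrNothing 2F ∘ κ) e))
                                                           ≡⟨ three-zeros b _ _ _ x′ y′ z′ ⟩
        0ℚ ∎)
        where open ≡-Reasoning

    -- If `M` meets C, its own bond is splitting, because C has at least three vertices and so
    -- leaves `M`. Otherwise `M` serves as the hub U.
    detect-small : ∀ b M → length M ℕ.≤ 2 → ∃ (_∈ M) → Connected G (_∈ M) → Detected b ⊎ (b · cut G (member M) ≡ 0ℚ)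
    detect-small b M ≤2 (u , u∈) conn with Any.any? (onCycle? G C) M
    ... | no none = OffCycle.detect-M M ≤2 u u∈ conn (λ v∈ on → none (Any.map (λ { refl → on }) v∈)) b
    ... | yes some with w , w∈ , on ← find some = detect b (small-bond M ≤2 (u , u∈) conn) on (_ , refl)
            (dec-true (w ∈? M) w∈) (dec-false (vtx (proj₁ (cycle-escapes M ≤2)) ∈? M) (proj₂ (cycle-escapes M ≤2)))

    -- If none of the three cuts for the ends of `e` led to a detection, pairing the edge identity
    -- with `b` would give 2 · `b e` = 0.
    detect-edge : ∀ b e → b e ≢ 0ℚ → Detected b
    detect-edge b e be≢0 with detect-small b (u ∷ []) (s≤s z≤n) (u , here refl) (singleton-connected u)
                            | detect-small b (v ∷ []) (s≤s z≤n) (v , here refl) (singleton-connected v)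
                            | detect-small b (u ∷ v ∷ []) (s≤s (s≤s z≤n)) (u , here refl)
                                (pair-connected (e , inj₁ refl , zero))
      where u = proj₁ (ends e)
            v = proj₂ (ends e)
    ... | inj₁ d | _ | _ = d
    ... | inj₂ _ | inj₁ d | _ = d
    ... | inj₂ _ | inj₂ _ | inj₁ d = d
    ... | inj₂ p | inj₂ q | inj₂ r = ⊥-elim (be≢0 (*-cancel-0 2≢0 (begin
      b e * twoℚ                     ≡⟨ ℚₚ.*-distribˡ-+ (b e) 1ℚ 1ℚ ⟩
      b e * 1ℚ + b e * 1ℚ            ≡⟨ cong₂ _+_ b·δ b·δ ⟩
      b · δ e + b · δ e              ≡⟨ sym (·-+ b (δ e) (δ e)) ⟩
      b · (λ f → δ e f + δ e f)      ≡⟨ sym (+-identityˡ _) ⟩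
      0ℚ + b · (λ f → δ e f + δ e f)  ≡⟨ cong (_+ b · (λ f → δ e f + δ e f)) (sym r) ⟩
      b · cut G (member (u ∷ v ∷ [])) + b · (λ f → δ e f + δ e f)
                                     ≡⟨ sym (·-+ b _ _) ⟩
      b · (λ f → cut G (member (u ∷ v ∷ [])) f + (δ e f + δ e f))
                                     ≡⟨ Σ-cong (λ f → cong (b f *_) (sym (edge-identity {e} (inj₁ refl) f))) ⟩
      b · (λ f → cut G (member (u ∷ [])) f + cut G (member (v ∷ [])) f)
                                     ≡⟨ ·-+ b _ _ ⟩
      b · cut G (member (u ∷ [])) + b · cut G (member (v ∷ []))
                                     ≡⟨ cong₂ _+_ p q ⟩
      0ℚ ∎)))
      where
      open ≡-Reasoning
      u = proj₁ (ends e)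
      v = proj₂ (ends e)
      b·δ : b e * 1ℚ ≡ b · δ e
      b·δ = trans (ℚₚ.*-identityʳ (b e)) (sym (trans (·-comm b (δ e)) (Σ-δ e b)))

    -- If C were Hamiltonian, deleting both cycle neighbours of `vtx zero` would leave it adjacent
    -- to some `vtx j` with 1 < j < k'. The ends of this chord form one side of a bond, and the
    -- positions 0, 1, j, k' alternate between its sides.
    off-cycle-vertex : ∃ λ w → ¬ On w
    off-cycle-vertex with Finₚ.any? (λ w → ¬? (onCycle? G C w))
    ... | yes found = found
    ... | no none = ⊥-elim (chord (crossing (Fin._≟ vtx zero)
        (connected-∉ M (s≤s (s≤s z≤n)) (vtx zero) (vtx i₂) c₀∉ c₂∉) refl
                                       (λ eq → differ (toℕ-i₂ , refl) (λ ()) (vInj _ _ eq))))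
      where
      on : ∀ w → On w
      on w = decidable-stable (onCycle? G C w) (λ ¬on → none (w , ¬on))
      n≤ : n ℕ.≤ suc k'
      n≤ = Finₚ.injective⇒≤ {f = λ w → proj₁ (on w)}
        λ {w} {w′} eq → trans (sym (proj₂ (on w))) (trans (cong vtx eq) (proj₂ (on w′)))
      -- At least four vertices, so position 2 differs from both deleted neighbours and is a target
      -- for the path leaving `vtx zero`.
      3≤k' : 3 ℕ.≤ k'
      3≤k' = ℕ.s≤s⁻¹ (ℕₚ.≤-trans (proj₁ three) n≤)
      1< : 1 ℕ.< suc k'
      1< = s≤s (ℕₚ.≤-trans (s≤s z≤n) 3≤k')
      2< : 2 ℕ.< suc k'
      2< = s≤s (ℕₚ.≤-trans (s≤s (s≤s z≤n)) 3≤k')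
      i₁ = fromℕ< 1<
      i₂ = fromℕ< 2<
      toℕ-i₁ : toℕ i₁ ≡ 1
      toℕ-i₁ = Finₚ.toℕ-fromℕ< 1<
      toℕ-i₂ : toℕ i₂ ≡ 2
      toℕ-i₂ = Finₚ.toℕ-fromℕ< 2<
      last = fromℕ k'
      toℕ-last : toℕ last ≡ k'
      toℕ-last = Finₚ.toℕ-fromℕ k'
      M = vtx i₁ ∷ vtx last ∷ []
      differ : ∀ {x y} {i j : Fin (suc k')} → toℕ i ≡ x × toℕ j ≡ y → x ≢ y → i ≢ j
      differ (refl , refl) ne refl = ne refl
      ∉M : ∀ {i x} → toℕ i ≡ x → x ≢ 1 → x ≢ k' → vtx i ∉ M
      ∉M eq ne _ (here p)          = differ (eq , toℕ-i₁) ne (vInj _ _ p)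
      ∉M eq _ ne (there (here p)) = differ (eq , toℕ-last) ne (vInj _ _ p)
      c₀∉ : vtx zero ∉ M
      c₀∉ = ∉M refl (λ ()) (ℕₚ.<⇒≢ (ℕₚ.≤-trans (s≤s z≤n) 3≤k'))
      c₂∉ : vtx i₂ ∉ M
      c₂∉ = ∉M toℕ-i₂ (λ ()) (ℕₚ.<⇒≢ 3≤k')
      chord : (∃ λ x → ∃ λ y → x ∉ M × y ∉ M × x ≡ vtx zero × y ≢ vtx zero × _~_ G x y) → ⊥
      chord (x , y , _ , y∉ , refl , y≢ , e) with j , refl ← on y =
        no-alternation (small-bond N (s≤s (s≤s z≤n)) (_ , here refl) (pair-connected e))
          (zero , i₁ , j , last ,
           subst (0 ℕ.<_) (sym toℕ-i₁) (s≤s z≤n) ,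
           subst (ℕ._< toℕ j) (sym toℕ-i₁) 1<j ,
           subst (toℕ j ℕ.<_) (sym toℕ-last) j<k' ,
           trans (out i₁ (λ ()) (λ { refl → y∉ (here refl) })) (sym (cong not h₀)) ,
           trans (dec-true (vtx j ∈? N) (there (here refl))) (sym h₀) ,
           trans (out last (λ eq → differ (toℕ-last , refl) (λ { refl → ℕₚ.n≮0 3≤k' }) eq)
                             (λ { refl → y∉ (there (here refl)) })) (sym (cong not h₀)))
        where
        N = vtx zero ∷ vtx j ∷ []
        h₀ : member N (vtx zero) ≡ true
        h₀ = dec-true (vtx zero ∈? N) (here refl)
        out : ∀ i → i ≢ zero → i ≢ j → member N (vtx i) ≡ false
        out i ne₀ neⱼ = dec-false (vtx i ∈? N) λ { (here p) → ne₀ (vInj _ _ p) ; (there (here p)) → neⱼ (vInj _ _ p) }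
        1<j : 1 ℕ.< toℕ j
        1<j = ℕₚ.≤∧≢⇒< (ℕₚ.n≢0⇒n>0 (λ eq → y≢ (cong vtx (Finₚ.toℕ-injective eq))))
                (λ eq → y∉ (here (cong vtx (Finₚ.toℕ-injective (trans (sym eq) (sym toℕ-i₁))))))
        j<k' : toℕ j ℕ.< k'
        j<k' = ℕₚ.≤∧≢⇒< (ℕ.s≤s⁻¹ (Finₚ.toℕ<n j))
                 (λ eq → y∉ (there (here (cong vtx (Finₚ.toℕ-injective (trans eq (sym toℕ-last)))))))

    valid : ∀ x → InBondPolytope G x → a · x ℚ.≤ twoℚ
    valid x (k , S , λs , bonds , λ≥0 , Σλ≡1 , combination) = begin
      a · x                                              ≡⟨ Σ-cong (λ e → cong (a e *_) (combination e)) ⟩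
      a · (λ e → λs · (λ i → cutVec G (S i) e))          ≡⟨ ·-combination a λs (λ i → cutVec G (S i)) ⟩
      λs · (λ i → a · cutVec G (S i))
        ≤⟨ Σ-mono (λ i → ℚₚ.*-monoˡ-≤-nonNeg (λs i) {{ℚ.nonNegative (λ≥0 i)}} (bound i)) ⟩
      λs · (λ _ → twoℚ)                                  ≡⟨ Σμ*c λs (λ _ → refl) ⟩
      Σℚ λs * twoℚ                                       ≡⟨ cong (_* twoℚ) Σλ≡1 ⟩
      1ℚ * twoℚ                                          ≡⟨ ℚₚ.*-identityˡ twoℚ ⟩
      twoℚ                                               ∎
      where
      open ℚₚ.≤-Reasoning
      bound : ∀ i → a · cutVec G (S i) ℚ.≤ twoℚ
      bound i = subst (ℚ._≤ twoℚ) (Σ-cong (λ e → cong (a e *_) (sym (cutVec≡cut G (S i) e))))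
                      (bond-≤2 (isBond⇒bond G (bonds i)))

    facet : DefinesFacet (InBondPolytope G) a twoℚ
    facet = facet-from-detection (InBondPolytope G) a 2≢0 valid detect-face (cut G star) (bond-in-polytope G star-bond)
              star-off (Fin⇒suc (edg zero))
      where
      detect-face : ∀ b → NonZeroVector b → ∃ λ x → (InBondPolytope G x × a · x ≡ twoℚ) × b · x ≢ 0ℚ
      detect-face b (e , be≢0) with h , bond , on , ≢0 ← detect-edge b e be≢0 =
        cut G h , (bond-in-polytope G bond , on) , ≢0
      w = proj₁ off-cycle-vertex
      star = member (w ∷ [])
      star-bond = small-bond (w ∷ []) (s≤s z≤n) (w , here refl) (singleton-connected w)
      off : ∀ i → star (vtx i) ≡ false
      off i = dec-false (vtx i ∈? (w ∷ [])) λ { (here p) → proj₂ off-cycle-vertex (i , p) }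
      star-off : a · cut G star ≡ 0ℚ
      star-off = trans (cycleVec-cut G C star) (Σ-zero (λ i → cong₂ indicatorXor (off i) (off (nextF G i))))

theorem6p5 : (G : Graph) → ThreeConnected G → (C : Cycle G) → ¬ Interleaved G C →
    DefinesFacet (InBondPolytope G) (cycleVec G C) twoℚ
theorem6p5 = facet
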